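{- For a word $w$ over a finite alphabet, the execution of the algorithm $\mathrm{GetAnAttractor}(\mathcal{S}(w))$ on the suffix automaton (DAWG) $\mathcal{S}(w)$ of $w$ that produces a word attractor $P$ runs in time $O(|w|\cdot|P|)$.
   Context: Let $w=w_1w_2\cdots w_n$ be a finite word over a finite alphabet, $n\ge 0$, $|w|=n$. Positions on $w$ are the elements of $\{1,\dots,n\}$. A factor of $w$ is a word $w_{[i,j]}=w_i\cdots w_j$ (the empty word if $j<i$). An occurrence of a non-empty factor $u$ in $w$ is a pair $(i,j)$, $1\le i\le j\le n$, with $u=w_{[i,j]}$; $j$ is its ending position. A set $P\subseteq\{1,\dots,n\}$ is a word attractor of $w$ if every non-empty factor $u$ of $w$ has an occurrence $(i,j)$ in $w$ with $i\le t\le j$ for some $t\in P$. Suffix automaton (DAWG): the states of $\mathcal{S}(w)$ are the equivalence classes of the factors of $w$ (including the empty word), where two factors are equivalent iff they have the same set of ending positions in $w$ (the empty word having ending positions $0,1,\dots,n$). $|\mathcal{S}(w)|$ is the number of states. The initial state $I$ is the class of the empty word. For a factor $u$, $\delta(I,u)$ is the class of $u$. For a state $q$, $\ell[q]$ is the minimum length of the factors in $q$ and $\mathrm{POS}[q]$ is the smallest ending position of any factor in $q$ (so $\mathrm{POS}[I]=0$). Suffix links: for a state $q\neq I$ and any factor $x\in q$, $F[q]$ is the class of the longest suffix of $x$ that does not belong to $q$ (independent of the choice of $x$). The table of prefix states is $T[j]=\delta(I,w_{[1,j]})$ for $1\le j\le n$. The input $\mathcal{S}(w)$ is given with its tables $F$,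 $\ell$, $T$, $\mathrm{POS}$ already computed. Time is counted in the usual unit-cost RAM model (assignments, comparisons, integer arithmetic, table accesses, inserting a state into $\mathit{checked}$, maintaining its cardinality, and inserting a position into $P$ each cost $O(1)$). Algorithm $\mathrm{GetAnAttractor}(\mathcal{S}(w))$: Initialization: for all states $q$ set $d[q]\leftarrow+\infty$; set $P\leftarrow\emptyset$, $\mathit{checked}\leftarrow\{I\}$, $j\leftarrow|w|$. While $j>0$ do: (a) [stacking] set $i\leftarrow j$, $k\leftarrow 1$; while $k\le i$ do: set $q\leftarrow T[i]$; while $\mathrm{POS}[q]=i$ do { if $d[q]\ge\ell[q]$ then set $k\leftarrow\max\{k,\,i-\ell[q]+1\}$; set $q\leftarrow F[q]$ }; set $i\leftarrow i-1$. (b) [adding] set $P\leftarrow P\cup\{k\}$. (c) [updating] for $i=k,k+1,\dots,j$ in this order do: set $e\leftarrow i-k$, $q\leftarrow T[i]$; while $q\neq I$ and $e<d[q]$ do { set $d[q]\leftarrow e$; if $d[q]<\ell[q]$ then { set $\mathit{checked}\leftarrow\mathit{checked}\cup\{q\}$; if $|\mathit{checked}|=|\mathcal{S}(w)|$ then return $P$ and stop }; set $q\leftarrow F[q]$ }. (d) set $j\leftarrow k-1$. -}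

module Defs where

open import Data.Empty using (⊥-elim)
open import Data.Fin.Base using (Fin)
open import Data.Fin.Subset using (Subset; ⁅_⁆; _∪_) renaming (∣_∣ to card)
open import Data.List.Base using (List; []; _∷_; length; take; drop; allFin)
open import Data.List.Membership.DecPropositional using () renaming (_∈?_ to mem?)
open import Data.List.Membership.Propositional using (_∈_)
open import Data.List.Relation.Binary.Suffix.Heterogeneous using (Suffix)
open import Data.List.Relation.Unary.All using (All)
open import Data.Nat.Base using (ℕ; suc; z≤n; s≤s; _+_; _∸_; _⊔_; _≤_; _<_)
open import Data.Nat.Properties using (_≟_)
open import Data.Product.Base using (Σ; ∃₂; ∃-syntax; _×_; _,_; proj₁)
open import Data.Sum.Base using (_⊎_)
open import Data.Vec.Base using (Vec; lookup; _[_]≔_)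
open import Function.Bundles using (_⇔_)
open import Relation.Binary.Construct.Add.Supremum.NonStrict _≤_ using (_≤⁺_)
open import Relation.Binary.Construct.Add.Supremum.Strict _<_ using (_<⁺_)
open import Relation.Binary.PropositionalEquality.Core using (_≡_; _≢_; refl)
open import Relation.Nullary.Construct.Add.Supremum using (_⁺; ⊤⁺; [_])
open import Relation.Nullary.Decidable.Core using (yes; no)
open import Relation.Nullary.Negation.Core using (¬_)

------------------------------------------------------------------------
-- Words and attractors

module _ {A : Set} where

  -- w_i ⋯ w_j with positions counted from 1; empty when j < i.
  _⟦_⋯_⟧ : List A → ℕ → ℕ → List A
  w ⟦ i ⋯ j ⟧ = take (suc j ∸ i) (drop (i ∸ 1) w)

  Factor : List A → List A → Set
  Factor w u = ∃₂ λ i j → 1 ≤ i × j ≤ length w × u ≡ w ⟦ i ⋯ j ⟧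

  -- 1 ≤ i ≤ j ≤ ∣w∣ already forces u to be non-empty.
  Occurrence : List A → List A → ℕ → ℕ → Set
  Occurrence w u i j = 1 ≤ i × i ≤ j × j ≤ length w × u ≡ w ⟦ i ⋯ j ⟧

  -- The first summand: the empty word has ending positions 0, 1, …, ∣w∣.
  EndsAt : List A → List A → ℕ → Set
  EndsAt w u j = (u ≡ [] × j ≤ length w) ⊎ (∃[ i ] Occurrence w u i j)

  EndEquivalent : List A → List A → List A → Set
  EndEquivalent w u v = ∀ j → EndsAt w u j ⇔ EndsAt w v j

  IsAttractor : List A → List ℕ → Set
  IsAttractor w P =
    All (λ t → 1 ≤ t × t ≤ length w) P ×
    (∀ u → u ≢ [] → Factor w u →
      ∃₂ λ i j → Occurrence w u i j × (∃[ t ] (t ∈ P × i ≤ t × t ≤ j)))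

  []-factor : ∀ w → Factor w []
  []-factor w = 1 , 0 , s≤s z≤n , z≤n , refl

------------------------------------------------------------------------
-- The suffix automaton together with its tables

-- The quotient of the factors of w by EndEquivalent, its classes being
-- numbered arbitrarily: δ is the quotient map u ↦ δ(I,u).  F is
-- unconstrained at I, and T outside 1 ≤ j ≤ ∣w∣, where the tables are
-- undefined.
record SuffixAutomaton {A : Set} (w : List A) : Set where
  field
    size         : ℕ
    δ            : ∀ u → Factor w u → Fin size
    δ-class      : ∀ {u v} (fu : Factor w u) (fv : Factor w v) →
                   (δ u fu ≡ δ v fv) ⇔ EndEquivalent w u v
    δ-surjective : ∀ q → ∃₂ λ u fu → δ u fu ≡ q

  State : Set
  State = Fin size

  initial : State
  initial = δ [] ([]-factor w)

  _∈ˢ_ : List A → State → Set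
  u ∈ˢ q = Σ (Factor w u) λ fu → δ u fu ≡ q

  LongestSuffixOutside : State → List A → List A → Set
  LongestSuffixOutside q x y =
    Suffix _≡_ y x × ¬ (y ∈ˢ q) ×
    (∀ z → Suffix _≡_ z x → ¬ (z ∈ˢ q) → length z ≤ length y)

  field
    F     : State → State
    F-def : ∀ q → q ≢ initial → ∀ x → x ∈ˢ q →
            ∃[ y ] (LongestSuffixOutside q x y × y ∈ˢ F q)

    ℓ     : State → ℕ
    ℓ-def : ∀ q → (∃[ x ] (x ∈ˢ q × length x ≡ ℓ q)) ×
                  (∀ x → x ∈ˢ q → ℓ q ≤ length x)

    POS     : State → ℕ
    POS-def : ∀ q → (∃[ x ] (x ∈ˢ q × EndsAt w x (POS q))) ×
                    (∀ x → x ∈ˢ q → ∀ j → EndsAt w x j → POS q ≤ j)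

    T     : ℕ → State
    T-def : ∀ j → 1 ≤ j → j ≤ length w → (w ⟦ 1 ⋯ j ⟧) ∈ˢ T j

------------------------------------------------------------------------
-- Unit-cost RAM programs over the suffix automaton

-- Duplicate-free lists as finite sets of positions.
insert : ℕ → List ℕ → List ℕ
insert k P with mem? _≟_ k P
... | yes _ = P
... | no  _ = k ∷ P

module Algorithm {A : Set} {w : List A} (S : SuffixAutomaton w) where

  open SuffixAutomaton S using (State; size; initial)

  record Store : Set where
    field
      i j k e : ℕ
      q       : State
      d       : Vec (ℕ ⁺) size
      P       : List ℕ
      checked : Subset size

  data Type : Set where
    nat dist state : Type

  Value : Type → Set
  Value nat   = ℕ
  Value dist  = ℕ ⁺
  Value state = State

  data Var : Type → Set where
    i j k e : Var nat
    q       : Var state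

  read : ∀ {τ} → Var τ → Store → Value τ
  read i s = Store.i s
  read j s = Store.j s
  read k s = Store.k s
  read e s = Store.e s
  read q s = Store.q s

  write : ∀ {τ} → Var τ → Value τ → Store → Store
  write i x s = record s { i = x }
  write j x s = record s { j = x }
  write k x s = record s { k = x }
  write e x s = record s { e = x }
  write q x s = record s { q = x }

  infixl 6 _⊕_ _⊖_

  data Exp : Type → Set where
    var            : ∀ {τ} → Var τ → Exp τ
    lit            : ℕ → Exp nat
    _⊕_ _⊖_ max    : Exp nat → Exp nat → Exp nat
    ∣w∣ ∣S∣ ∣checked∣ : Exp nat
    I              : Exp state
    ℓ[_] POS[_]    : Exp state → Exp nat
    F[_]           : Exp state → Exp state
    T[_]           : Exp nat → Exp state
    d[_]           : Exp state → Exp dist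
    ∞              : Exp dist
    fin            : Exp nat → Exp dist

  eval : ∀ {τ} → Exp τ → Store → Value τ
  eval (var x)   s = read x s
  eval (lit n)   s = n
  eval (a ⊕ b)   s = eval a s + eval b s
  -- No subtraction made by the program below is ever truncated.
  eval (a ⊖ b)   s = eval a s ∸ eval b s
  eval (max a b) s = eval a s ⊔ eval b s
  eval ∣w∣       s = length w
  eval ∣S∣       s = size
  eval ∣checked∣ s = card (Store.checked s)
  eval I         s = initial
  eval ℓ[ a ]    s = SuffixAutomaton.ℓ S (eval a s)
  eval POS[ a ]  s = SuffixAutomaton.POS S (eval a s)
  eval F[ a ]    s = SuffixAutomaton.F S (eval a s)
  eval T[ a ]    s = SuffixAutomaton.T S (eval a s)
  eval d[ a ]    s = lookup (Store.d s) (eval a s)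
  eval ∞         s = ⊤⁺
  eval (fin a)   s = [ eval a s ]

  expCost : ∀ {τ} → Exp τ → ℕ
  expCost (var _)   = 1
  expCost (lit _)   = 1
  expCost (a ⊕ b)   = 1 + expCost a + expCost b
  expCost (a ⊖ b)   = 1 + expCost a + expCost b
  expCost (max a b) = 1 + expCost a + expCost b
  expCost ∣w∣       = 1
  expCost ∣S∣       = 1
  expCost ∣checked∣ = 1
  expCost I         = 1
  expCost ℓ[ a ]    = 1 + expCost a
  expCost POS[ a ]  = 1 + expCost a
  expCost F[ a ]    = 1 + expCost a
  expCost T[ a ]    = 1 + expCost a
  expCost d[ a ]    = 1 + expCost a
  expCost ∞         = 1
  expCost (fin a)   = 1 + expCost a

  infix  5 _≤′_ _<′_ _≤ᵈ_ _<ᵈ_ _≡′_ _≢′_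
  infixr 4 _and_

  data Test : Set where
    _≤′_ _<′_ : Exp nat → Exp nat → Test
    _≤ᵈ_ _<ᵈ_ : Exp dist → Exp dist → Test
    _≡′_      : Exp nat → Exp nat → Test
    _≢′_      : Exp state → Exp state → Test
    _and_     : Test → Test → Test

  Holds : Test → Store → Set
  Holds (a ≤′ b)  s = eval a s ≤ eval b s
  Holds (a <′ b)  s = eval a s < eval b s
  Holds (a ≤ᵈ b)  s = eval a s ≤⁺ eval b s
  Holds (a <ᵈ b)  s = eval a s <⁺ eval b s
  Holds (a ≡′ b)  s = eval a s ≡ eval b s
  Holds (a ≢′ b)  s = eval a s ≢ eval b s
  Holds (b and c) s = Holds b s × Holds c s

  testCost : Test → ℕ
  testCost (a ≤′ b)  = 1 + expCost a + expCost b
  testCost (a <′ b)  = 1 + expCost a + expCost b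
  testCost (a ≤ᵈ b)  = 1 + expCost a + expCost b
  testCost (a <ᵈ b)  = 1 + expCost a + expCost b
  testCost (a ≡′ b)  = 1 + expCost a + expCost b
  testCost (a ≢′ b)  = 1 + expCost a + expCost b
  testCost (b and c) = 1 + testCost b + testCost c

  infix 3 _≔_ d[_]≔_

  data Instr : Set where
    _≔_            : ∀ {τ} → Var τ → Exp τ → Instr
    d[_]≔_         : Exp state → Exp dist → Instr
    P≔∅            : Instr
    P≔P∪｛_｝       : Exp nat → Instr
    checked≔｛_｝   : Exp state → Instr
    checked≔checked∪｛_｝ : Exp state → Instr

  perform : Instr → Store → Store
  perform (x ≔ a)                    s = write x (eval a s) s
  perform (d[ a ]≔ b)                s =
    record s { d = Store.d s [ eval a s ]≔ eval b s }
  perform P≔∅                        s = record s { P = [] }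
  perform P≔P∪｛ a ｝                s = record s { P = insert (eval a s) (Store.P s) }
  perform checked≔｛ a ｝            s = record s { checked = ⁅ eval a s ⁆ }
  perform checked≔checked∪｛ a ｝    s =
    record s { checked = Store.checked s ∪ ⁅ eval a s ⁆ }

  instrCost : Instr → ℕ
  instrCost (x ≔ a)                  = 1 + expCost a
  instrCost (d[ a ]≔ b)              = 1 + expCost a + expCost b
  instrCost P≔∅                      = 1
  instrCost P≔P∪｛ a ｝              = 1 + expCost a
  instrCost checked≔｛ a ｝          = 1 + expCost a
  instrCost checked≔checked∪｛ a ｝  = 1 + expCost a

  infixr 1 _⨾_
  infix  2 if_then_ while_repeat_ for-q∈_repeat_ for_from_to_repeat_

  data Cmd : Set where
    do!         : Instr → Cmd
    _⨾_         : Cmd → Cmd → Cmd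
    if_then_    : Test → Cmd → Cmd
    while_repeat_   : Test → Cmd → Cmd
    for-q∈_repeat_  : List State → Cmd → Cmd
    return      : Cmd

  for_from_to_repeat_ : Var nat → Exp nat → Exp nat → Cmd → Cmd
  for x from a to b repeat c =
    do! (x ≔ a) ⨾
    (while var x ≤′ b repeat (c ⨾ do! (x ≔ var x ⊕ lit 1)))

  data Outcome : Set where
    normal returned : Outcome

  infix 0 ⟨_,_⟩⇓⟨_,_⟩_

  -- ⟨ c , s ⟩⇓⟨ o , s′ ⟩ t: from store s, command c halts after t unit
  -- operations in store s′, having executed return iff o ≡ returned.
  data ⟨_,_⟩⇓⟨_,_⟩_ : Cmd → Store → Outcome → Store → ℕ → Set where

    do! : ∀ {a s} → ⟨ do! a , s ⟩⇓⟨ normal , perform a s ⟩ instrCost a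

    seq : ∀ {c₁ c₂ s s₁ s₂ o t₁ t₂} →
          ⟨ c₁ , s ⟩⇓⟨ normal , s₁ ⟩ t₁ →
          ⟨ c₂ , s₁ ⟩⇓⟨ o , s₂ ⟩ t₂ →
          ⟨ c₁ ⨾ c₂ , s ⟩⇓⟨ o , s₂ ⟩ (t₁ + t₂)
    seq-returned : ∀ {c₁ c₂ s s₁ t₁} →
          ⟨ c₁ , s ⟩⇓⟨ returned , s₁ ⟩ t₁ →
          ⟨ c₁ ⨾ c₂ , s ⟩⇓⟨ returned , s₁ ⟩ t₁

    if-true : ∀ {b c s s₁ o t} → Holds b s →
          ⟨ c , s ⟩⇓⟨ o , s₁ ⟩ t →
          ⟨ if b then c , s ⟩⇓⟨ o , s₁ ⟩ (testCost b + t)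
    if-false : ∀ {b c s} → ¬ Holds b s →
          ⟨ if b then c , s ⟩⇓⟨ normal , s ⟩ testCost b

    while-true : ∀ {b c s s₁ s₂ o t₁ t₂} → Holds b s →
          ⟨ c , s ⟩⇓⟨ normal , s₁ ⟩ t₁ →
          ⟨ while b repeat c , s₁ ⟩⇓⟨ o , s₂ ⟩ t₂ →
          ⟨ while b repeat c , s ⟩⇓⟨ o , s₂ ⟩ (testCost b + t₁ + t₂)
    while-returned : ∀ {b c s s₁ t₁} → Holds b s →
          ⟨ c , s ⟩⇓⟨ returned , s₁ ⟩ t₁ →
          ⟨ while b repeat c , s ⟩⇓⟨ returned , s₁ ⟩ (testCost b + t₁)
    while-false : ∀ {b c s} → ¬ Holds b s →
          ⟨ while b repeat c , s ⟩⇓⟨ normal , s ⟩ testCost b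

    for-[] : ∀ {c s} →
          ⟨ for-q∈ [] repeat c , s ⟩⇓⟨ normal , s ⟩ 1
    for-∷ : ∀ {x xs c s s₁ s₂ o t₁ t₂} →
          ⟨ c , write q x s ⟩⇓⟨ normal , s₁ ⟩ t₁ →
          ⟨ for-q∈ xs repeat c , s₁ ⟩⇓⟨ o , s₂ ⟩ t₂ →
          ⟨ for-q∈ (x ∷ xs) repeat c , s ⟩⇓⟨ o , s₂ ⟩ (1 + t₁ + t₂)
    for-returned : ∀ {x xs c s s₁ t₁} →
          ⟨ c , write q x s ⟩⇓⟨ returned , s₁ ⟩ t₁ →
          ⟨ for-q∈ (x ∷ xs) repeat c , s ⟩⇓⟨ returned , s₁ ⟩ (1 + t₁)

    return : ∀ {s} → ⟨ return , s ⟩⇓⟨ returned , s ⟩ 1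

  deterministic : ∀ {c s o o′ s₁ s₁′ t t′} →
    ⟨ c , s ⟩⇓⟨ o , s₁ ⟩ t → ⟨ c , s ⟩⇓⟨ o′ , s₁′ ⟩ t′ →
    o ≡ o′ × s₁ ≡ s₁′ × t ≡ t′
  deterministic do! do! = refl , refl , refl
  deterministic (seq x y) (seq x′ y′)
    with refl , refl , refl ← deterministic x x′
    with refl , refl , refl ← deterministic y y′ = refl , refl , refl
  deterministic (seq x y) (seq-returned x′) with () ← proj₁ (deterministic x x′)
  deterministic (seq-returned x) (seq x′ _) with () ← proj₁ (deterministic x x′)
  deterministic (seq-returned x) (seq-returned x′)
    with refl , refl , refl ← deterministic x x′ = refl , refl , refl
  deterministic (if-true _ x) (if-true _ x′)
    with refl , refl , refl ← deterministic x x′ = refl , refl , refl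
  deterministic (if-true h _) (if-false n) = ⊥-elim (n h)
  deterministic (if-false n) (if-true h _) = ⊥-elim (n h)
  deterministic (if-false _) (if-false _) = refl , refl , refl
  deterministic (while-true _ x y) (while-true _ x′ y′)
    with refl , refl , refl ← deterministic x x′
    with refl , refl , refl ← deterministic y y′ = refl , refl , refl
  deterministic (while-true _ x _) (while-returned _ x′) with () ← proj₁ (deterministic x x′)
  deterministic (while-true h _ _) (while-false n) = ⊥-elim (n h)
  deterministic (while-returned _ x) (while-true _ x′ _) with () ← proj₁ (deterministic x x′)
  deterministic (while-returned _ x) (while-returned _ x′)
    with refl , refl , refl ← deterministic x x′ = refl , refl , refl
  deterministic (while-returned h _) (while-false n) = ⊥-elim (n h)
  deterministic (while-false n) (while-true h _ _) = ⊥-elim (n h)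
  deterministic (while-false n) (while-returned h _) = ⊥-elim (n h)
  deterministic (while-false _) (while-false _) = refl , refl , refl
  deterministic for-[] for-[] = refl , refl , refl
  deterministic (for-∷ x y) (for-∷ x′ y′)
    with refl , refl , refl ← deterministic x x′
    with refl , refl , refl ← deterministic y y′ = refl , refl , refl
  deterministic (for-∷ x _) (for-returned x′) with () ← proj₁ (deterministic x x′)
  deterministic (for-returned x) (for-∷ x′ _) with () ← proj₁ (deterministic x x′)
  deterministic (for-returned x) (for-returned x′)
    with refl , refl , refl ← deterministic x x′ = refl , refl , refl
  deterministic return return = refl , refl , refl

------------------------------------------------------------------------
-- The algorithm

  initialization stacking adding updating getAnAttractor : Cmd

  initialization =
    (for-q∈ allFin size repeat do! (d[ var q ]≔ ∞)) ⨾
    do! P≔∅ ⨾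
    do! checked≔｛ I ｝ ⨾
    do! (j ≔ ∣w∣)

  stacking =
    do! (i ≔ var j) ⨾
    do! (k ≔ lit 1) ⨾
    (while var k ≤′ var i repeat
      ( do! (q ≔ T[ var i ]) ⨾
        (while POS[ var q ] ≡′ var i repeat
          ( (if fin ℓ[ var q ] ≤ᵈ d[ var q ] then
              do! (k ≔ max (var k) (var i ⊖ ℓ[ var q ] ⊕ lit 1))) ⨾
            do! (q ≔ F[ var q ]))) ⨾
        do! (i ≔ var i ⊖ lit 1)))

  adding = do! P≔P∪｛ var k ｝

  updating =
    for i from var k to var j repeat
      ( do! (e ≔ var i ⊖ var k) ⨾
        do! (q ≔ T[ var i ]) ⨾
        (while (var q ≢′ I) and (fin (var e) <ᵈ d[ var q ]) repeat
          ( do! (d[ var q ]≔ fin (var e)) ⨾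
            (if d[ var q ] <ᵈ fin ℓ[ var q ] then
              ( do! checked≔checked∪｛ var q ｝ ⨾
                (if ∣checked∣ ≡′ ∣S∣ then return))) ⨾
            do! (q ≔ F[ var q ]))))

  getAnAttractor =
    initialization ⨾
    (while lit 0 <′ var j repeat
      ( stacking ⨾
        adding ⨾
        updating ⨾
        do! (j ≔ var k ⊖ lit 1)))

  -- The value produced is the content of P on halting, whether or not
  -- return was reached (it is not when w is empty).
  getAnAttractor-from_produces_inTime_ : Store → List ℕ → ℕ → Set
  getAnAttractor-from s₀ produces P inTime t =
    ∃₂ λ o s → (⟨ getAnAttractor , s₀ ⟩⇓⟨ o , s ⟩ t) × P ≡ Store.P s

{-# OPTIONS --safe #-}

-- The states whose words end at a given position form a chain: they are
-- determined and ordered by ℓ, and F moves down to the next one.  Hence the end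
-- position sets are nested or disjoint, which bounds the number of states by
-- 2 (∣w∣ + 1).  In one iteration of the main loop, stacking visits a state q only
-- at i = POS q, and updating visits it at most once, since e increases and
-- stays below d[q]; so an iteration costs O(∣w∣), and each adds a new position
-- to P.  The walks of updating may stop at a state q with d[q] ≤ e, because
-- whatever set d[q] did the same for the states below q in the chain; therefore
-- once an iteration has treated the positions down to k, every state with
-- POS q ≥ k has d[q] < ℓ[q], that is, all of its words are covered.
module Submission where

open import Defs
open import Data.Empty using (⊥)
open import Data.Bool.Base using (true)
open import Data.Fin.Base using (Fin; zero; toℕ; fromℕ<; join; splitAt)
import Data.Fin.Properties as Fin
open import Data.Fin.Subset as Subset using (Subset; ⁅_⁆; _∪_) renaming (∣_∣ to card)
import Data.Fin.Subset.Properties as Subset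
open import Data.List.Base using (List; []; _∷_; _++_; length; take; drop; allFin)
import Data.List.Properties as List
open import Data.List.Membership.DecPropositional using () renaming (_∈?_ to mem?)
open import Data.List.Membership.Propositional using (_∈_)
open import Data.List.Membership.Propositional.Properties using (∈-allFin)
open import Data.List.Relation.Binary.Pointwise using (Pointwise-≡⇒≡; ≡⇒Pointwise-≡)
open import Data.List.Relation.Binary.Suffix.Heterogeneous as Suffix using (Suffix; here; there; _++ˢ_)
import Data.List.Relation.Binary.Suffix.Heterogeneous.Properties as Suffix
open import Data.List.Relation.Unary.All as All using (All; []; _∷_)
open import Data.List.Relation.Unary.Any using (here; there)
open import Data.Nat.Base hiding (_≤′_; _<′_)
open import Data.Nat.Induction using (<-rec)
open import Data.Nat.Properties
open import Data.Nat.Solver using (module +-*-Solver)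
open import Data.Product.Base
open import Data.Sum.Base as Sum using (_⊎_; inj₁; inj₂; [_,_]′)
open import Data.Vec.Base using (Vec; lookup; tabulate; _[_]≔_)
import Data.Vec.Properties as Vec
open import Function.Base using (_∘_; case_of_)
open import Function.Bundles using (mk⇔; Equivalence)
open import Function.Definitions using (Injective)
open import Relation.Binary.Construct.Add.Supremum.NonStrict _≤_
  using (_≤⁺_; [_]; _≤⊤⁺; ≤⁺-trans; ≤⁺-reflexive-≡; ≤⁺-dec)
open import Relation.Binary.Construct.Add.Supremum.Strict _<_
  using (_<⁺_; [_]; [_]<⊤⁺; [<]-injective; <⁺-transʳ; <⁺-transˡ; <⁺-dec)
open import Relation.Binary.Definitions using (DecidableEquality; tri<; tri≈; tri>)
open import Relation.Binary.PropositionalEquality hiding (J)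
open import Relation.Nullary
  using (¬_; Dec; yes; no; ¬?; does; contradiction; _×-dec_; _⊎-dec_; decidable-stable)
open import Relation.Nullary.Construct.Add.Supremum using (_⁺; ⊤⁺; [_]; []-injective)
open import Relation.Nullary.Decidable using (dec-true)

-- Halting, running time and the attractor property are proved together in `WP`, a total-correctness
-- statement with a time budget whose loop invariants carry potentials: numbers of states that may
-- still be visited. The number of rounds is not known in advance, so only a single iteration
-- receives a budget; the whole run is bounded afterwards through `length P`, using that every round
-- inserts a position to the left of all earlier ones. The attractor property also enters the bound:
-- for a non-empty word it gives `1 ≤ length P`, so that the linear cost of initialization is
-- absorbed by the product. The delicate invariant is the soundness of `d`: a value m of `d` must
-- come with a position at which the whole chain has values at most m. In the middle of a walk this
-- fails for the states just updated, since those below them have not been treated yet.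

-- Suffixes and ending positions

module _ {A : Set} where

  private variable
    x y z : List A

  suffix-trans : Suffix _≡_ x y → Suffix _≡_ y z → Suffix _≡_ x z
  suffix-trans = Suffix.trans trans

  suffix-drop : ∀ m (x : List A) → Suffix _≡_ (drop m x) x
  suffix-drop m x =
    subst (Suffix _≡_ (drop m x)) (List.take++drop≡id m x) (take m x ++ˢ here (≡⇒Pointwise-≡ refl))

  suffix-comparable : Suffix _≡_ x z → Suffix _≡_ y z → length x ≤ length y → Suffix _≡_ x y
  suffix-comparable x⊑z (here y≋z) _ with refl ← Pointwise-≡⇒≡ y≋z = x⊑z
  suffix-comparable (there x⊑z) (there y⊑z) x≤y = suffix-comparable x⊑z y⊑z x≤y
  suffix-comparable (here x≋z) (there y⊑z) x≤y with refl ← Pointwise-≡⇒≡ x≋z =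
    contradiction (≤-trans x≤y (Suffix.length-mono y⊑z)) 1+n≰n

  suffix-[] : ∀ (x : List A) → Suffix _≡_ [] x
  suffix-[] x = subst (λ y → Suffix _≡_ y x) (List.drop-all (length x) x ≤-refl) (suffix-drop (length x) x)

  window≡drop-take : ∀ (w : List A) m p → m ≤ p → w ⟦ suc m ⋯ p ⟧ ≡ drop m (take p w)
  window≡drop-take w m p m≤p =
    trans (List.take-drop (p ∸ m) m w) (cong (λ l → drop m (take l w)) (m+[n∸m]≡n m≤p))

  drop-length-++ : ∀ (x : List A) → drop (length x) (x ++ y) ≡ y
  drop-length-++ []      = refl
  drop-length-++ (_ ∷ x) = drop-length-++ x

  length-take-≤ : ∀ (w : List A) p → p ≤ length w → length (take p w) ≡ p
  length-take-≤ w p p≤n = trans (List.length-take p w) (m≤n⇒m⊓n≡m p≤n)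

  -- Unlike `EndsAt`, this form has no separate case for the empty word, and inclusions between sets
  -- of ending positions become transitivity of the suffix relation.
  Ends : List A → List A → ℕ → Set
  Ends w u p = p ≤ length w × Suffix _≡_ u (take p w)

  ends-[] : ∀ (w : List A) {p} → p ≤ length w → Ends w [] p
  ends-[] w p≤n = p≤n , suffix-[] _

  module _ {w u : List A} where

    ends-0 : Ends w u 0 → u ≡ []
    ends-0 (_ , here []≋) = Pointwise-≡⇒≡ []≋

    ends-length : ∀ {p} → Ends w u p → length u ≤ p
    ends-length {p} (p≤n , u⊑) = subst (length u ≤_) (length-take-≤ w p p≤n) (Suffix.length-mono u⊑)

    occurrence⇒ends : ∀ {i p} → Occurrence w u i p → Ends w u p
    occurrence⇒ends {suc i} {p} (_ , i<p , p≤n , refl) =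
      p≤n , subst (λ v → Suffix _≡_ v (take p w)) (sym (window≡drop-take w i p (<⇒≤ i<p)))
              (suffix-drop i (take p w))

    ends⇒occurrence : ∀ {p} → u ≢ [] → Ends w u p → ∃[ i ] (Occurrence w u i p × i + length u ≡ suc p)
    ends⇒occurrence {p} u≢[] (p≤n , u⊑) = split (Suffix.toView u⊑) refl
      where
      split : ∀ {v} → Suffix.SuffixView _≡_ u v → v ≡ take p w →
              ∃[ i ] (Occurrence w u i p × i + length u ≡ suc p)
      split (cs Suffix.++ u≋) eq with refl ← Pointwise-≡⇒≡ u≋ =
        suc (length cs) , (s≤s z≤n , cs<p , p≤n , u≡) , cong suc |cs|+|u|≡p
        where
        |cs|+|u|≡p : length cs + length u ≡ p
        |cs|+|u|≡p = trans (sym (List.length-++ cs)) (trans (cong length eq) (length-take-≤ w p p≤n))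
        |u|>0 : ∀ v → v ≢ [] → 0 < length v
        |u|>0 []      v≢[] = contradiction refl v≢[]
        |u|>0 (_ ∷ _) _    = s≤s z≤n
        cs<p : length cs < p
        cs<p = subst (length cs <_) |cs|+|u|≡p (m<m+n (length cs) (|u|>0 u u≢[]))
        u≡ : u ≡ w ⟦ suc (length cs) ⋯ p ⟧
        u≡ = trans (sym (drop-length-++ cs))
               (trans (cong (drop (length cs)) eq) (sym (window≡drop-take w (length cs) p (<⇒≤ cs<p))))

    endsAt⇒ends : ∀ {p} → EndsAt w u p → Ends w u p
    endsAt⇒ends (inj₁ (refl , p≤n)) = ends-[] w p≤n
    endsAt⇒ends (inj₂ (_ , occ))    = occurrence⇒ends occ

  ends⇒endsAt : ∀ {w u : List A} {p} → Ends w u p → EndsAt w u p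
  ends⇒endsAt {u = []}    (p≤n , _) = inj₁ (refl , p≤n)
  ends⇒endsAt {u = _ ∷ _} u-ends    = inj₂ (map₂ proj₁ (ends⇒occurrence (λ ()) u-ends))

  ends⇒factor : ∀ {w u : List A} {p} → Ends w u p → Factor w u
  ends⇒factor {w} {[]}    _ = []-factor w
  ends⇒factor {u = _ ∷ _} u-ends
    with i , (1≤i , _ , p≤n , eq) , _ ← ends⇒occurrence (λ ()) u-ends = i , _ , 1≤i , p≤n , eq

-- The chain of states at an ending position

module StateProperties {A : Set} (_≟ᴬ_ : DecidableEquality A) {w : List A} (S : SuffixAutomaton w) where

  open SuffixAutomaton S
  open Equivalence using (to; from)

  shortest : State → List A
  shortest q = proj₁ (proj₁ (ℓ-def q))

  shortest∈ : ∀ q → shortest q ∈ˢ q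
  shortest∈ q = proj₁ (proj₂ (proj₁ (ℓ-def q)))

  length-shortest : ∀ q → length (shortest q) ≡ ℓ q
  length-shortest q = proj₂ (proj₂ (proj₁ (ℓ-def q)))

  infix 4 _endsAt_
  -- Any word of the class has the same ending positions. The shortest one ties them to `ℓ`: at a
  -- common position, comparing values of `ℓ` decides which representative is a suffix of the other.
  _endsAt_ : State → ℕ → Set
  q endsAt p = Ends w (shortest q) p

  endsAt? : ∀ q p → Dec (q endsAt p)
  endsAt? q p = (p ≤? length w) ×-dec Suffix.suffix? _≟ᴬ_ (shortest q) (take p w)

  private variable
    q r c : State
    p p′ : ℕ
    x y : List A

  ∈ˢ-ends : x ∈ˢ q → y ∈ˢ q → Ends w x p → Ends w y p
  ∈ˢ-ends {p = p} (fx , ex) (fy , ey) =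
    endsAt⇒ends ∘ to (to (δ-class fx fy) (trans ex (sym ey)) p) ∘ ends⇒endsAt

  ∈ˢ⇒endsAt : x ∈ˢ q → Ends w x p → q endsAt p
  ∈ˢ⇒endsAt x∈q = ∈ˢ-ends x∈q (shortest∈ _)

  endsAt⇒∈ˢ : x ∈ˢ q → q endsAt p → Ends w x p
  endsAt⇒∈ˢ = ∈ˢ-ends (shortest∈ _)

  ∈ˢ-extensional : x ∈ˢ q → y ∈ˢ r → (∀ p → Ends w x p → Ends w y p) → (∀ p → Ends w y p → Ends w x p) →
                   q ≡ r
  ∈ˢ-extensional (fx , ex) (fy , ey) x⇒y y⇒x = trans (sym ex) (trans (from (δ-class fx fy) x≈y) ey)
    where
    x≈y : EndEquivalent w _ _
    x≈y p = mk⇔ (ends⇒endsAt ∘ x⇒y p ∘ endsAt⇒ends) (ends⇒endsAt ∘ y⇒x p ∘ endsAt⇒ends)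

  endsAt-extensional : (∀ p → q endsAt p → r endsAt p) → (∀ p → r endsAt p → q endsAt p) → q ≡ r
  endsAt-extensional = ∈ˢ-extensional (shortest∈ _) (shortest∈ _)

  ends-suffix : Suffix _≡_ x y → Ends w y p → Ends w x p
  ends-suffix x⊑y = map₂ (suffix-trans x⊑y)

  shortest-suffix : q endsAt p → Ends w y p → ℓ q ≤ length y → Suffix _≡_ (shortest q) y
  shortest-suffix {q} {y = y} (_ , q⊑) (_ , y⊑) ℓ≤ =
    suffix-comparable q⊑ y⊑ (subst (_≤ length y) (sym (length-shortest q)) ℓ≤)

  shortest-⊑ : q endsAt p → r endsAt p → ℓ q ≤ ℓ r → Suffix _≡_ (shortest q) (shortest r)
  shortest-⊑ {q} {r = r} q-p r-p ℓ≤ =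
    shortest-suffix q-p r-p (subst (ℓ q ≤_) (sym (length-shortest r)) ℓ≤)

  -- A single common position makes the shorter representative a suffix of the longer one, hence
  -- present wherever the longer one ends. This is the nesting of ending sets.
  endsAt-mono : q endsAt p → r endsAt p → ℓ q ≤ ℓ r → r endsAt p′ → q endsAt p′
  endsAt-mono q-p r-p ℓ≤ = ends-suffix (shortest-⊑ q-p r-p ℓ≤)

  endsAt-unique : q endsAt p → r endsAt p → ℓ q ≡ ℓ r → q ≡ r
  endsAt-unique q-p r-p ℓ≡ =
    endsAt-extensional (λ _ → endsAt-mono r-p q-p (≤-reflexive (sym ℓ≡)))
                       (λ _ → endsAt-mono q-p r-p (≤-reflexive ℓ≡))

  -- `shortest q` is a suffix of `shortest r`, which is a suffix of `y`. So the ending positions of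
  -- `r` lie between those of `y` and those of `q`, which coincide.
  between : y ∈ˢ q → Ends w y p → r endsAt p → ℓ q ≤ ℓ r → ℓ r ≤ length y → r ≡ q
  between y∈q y-p r-p ℓq≤ℓr ℓr≤y =
    ∈ˢ-extensional (shortest∈ _) y∈q
      (λ _ → endsAt⇒∈ˢ y∈q ∘ endsAt-mono (∈ˢ⇒endsAt y∈q y-p) r-p ℓq≤ℓr)
      (λ _ → ends-suffix (shortest-suffix r-p y-p ℓr≤y))

  ℓ≤ : q endsAt p → ℓ q ≤ p
  ℓ≤ {q} {p} q-p = subst (_≤ p) (length-shortest q) (ends-length q-p)

  endsAt-POS : q endsAt POS q
  endsAt-POS {q} with _ , x∈q , x-POS ← proj₁ (POS-def q) = ∈ˢ⇒endsAt x∈q (endsAt⇒ends x-POS)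

  POS≤ : q endsAt p → POS q ≤ p
  POS≤ {q} {p} q-p = proj₂ (POS-def q) _ (shortest∈ q) p (ends⇒endsAt q-p)

  []∈initial : [] ∈ˢ initial
  []∈initial = []-factor w , refl

  initial-endsAt : p ≤ length w → initial endsAt p
  initial-endsAt p≤n = ∈ˢ⇒endsAt []∈initial (ends-[] w p≤n)

  endsAt-0 : q endsAt 0 → q ≡ initial
  endsAt-0 {q} q-0 = ∈ˢ-extensional (shortest∈ q) []∈initial
    (λ p q-p → ends-[] w (proj₁ q-p))
    (λ p []-p → subst (λ u → Ends w u p) (sym (ends-0 {w = w} q-0)) []-p)

  ℓ-initial : ℓ initial ≡ 0
  ℓ-initial = n≤0⇒n≡0 (ℓ≤ (initial-endsAt z≤n))

  ℓ≡0⇒initial : q endsAt p → ℓ q ≡ 0 → q ≡ initial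
  ℓ≡0⇒initial q-p ℓ≡0 = endsAt-unique q-p (initial-endsAt (proj₁ q-p)) (trans ℓ≡0 (sym ℓ-initial))

  ℓ>0 : q ≢ initial → 0 < ℓ q
  ℓ>0 {q} q≢I = n≢0⇒n>0 (q≢I ∘ ℓ≡0⇒initial endsAt-POS)

  POS>0 : q ≢ initial → 0 < POS q
  POS>0 {q} q≢I = n≢0⇒n>0 λ POS≡0 → q≢I (endsAt-0 (subst (q endsAt_) POS≡0 endsAt-POS))

  POS-initial : POS initial ≡ 0
  POS-initial = n≤0⇒n≡0 (POS≤ (initial-endsAt z≤n))

  T-endsAt : 1 ≤ p → p ≤ length w → T p endsAt p
  T-endsAt {p} 1≤p p≤n = ∈ˢ⇒endsAt (T-def p 1≤p p≤n) (p≤n , here (≡⇒Pointwise-≡ refl))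

  -- Otherwise `ℓ r` lies between `ℓ (T p)` and p, the length of the whole prefix. The prefix
  -- belongs to `T p`, so `between` identifies `r` with `T p`.
  T-lowest : 1 ≤ p → r endsAt p → ℓ r ≤ ℓ (T p)
  T-lowest {p} {r} 1≤p r-p@(p≤n , _) with ℓ r ≤? ℓ (T p)
  ... | yes ℓ≤ℓ = ℓ≤ℓ
  ... | no  ℓ≰ℓ = ≤-reflexive (cong ℓ (between (T-def p 1≤p p≤n) (p≤n , here (≡⇒Pointwise-≡ refl)) r-p
                    (<⇒≤ (≰⇒> ℓ≰ℓ)) (subst (ℓ r ≤_) (sym (length-take-≤ w p p≤n)) (ℓ≤ r-p))))

  module _ (q≢I : q ≢ initial) where

    private
      y₀ = proj₁ (F-def q q≢I _ (shortest∈ q))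
      outside : LongestSuffixOutside q (shortest q) y₀
      outside = proj₁ (proj₂ (F-def q q≢I _ (shortest∈ q)))
      y₀∈F : y₀ ∈ˢ F q
      y₀∈F = proj₂ (proj₂ (F-def q q≢I _ (shortest∈ q)))

      y₀-ends : q endsAt p → Ends w y₀ p
      y₀-ends = ends-suffix (proj₁ outside)

    F-endsAt : q endsAt p → F q endsAt p
    F-endsAt = ∈ˢ⇒endsAt y₀∈F ∘ y₀-ends

    ℓF< : ℓ (F q) < ℓ q
    ℓF< = ≤-<-trans (proj₂ (ℓ-def (F q)) _ y₀∈F) (subst (length y₀ <_) (length-shortest q) y₀<)
      where
      y₀< : length y₀ < length (shortest q)
      y₀< = ≤∧≢⇒< (Suffix.length-mono (proj₁ outside)) λ eq →
        proj₁ (proj₂ outside)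
          (subst (_∈ˢ q) (sym (Pointwise-≡⇒≡ (Suffix.toPointwise eq (proj₁ outside)))) (shortest∈ q))

    -- `shortest r` is a suffix of `shortest q` too short to belong to `q`, hence no longer than
    -- `y₀`, the longest such suffix. If it were longer than `ℓ (F q)`, `between` would give
    -- `r ≡ F q`.
    F-greatest : q endsAt p → r endsAt p → ℓ r < ℓ q → ℓ r ≤ ℓ (F q)
    F-greatest {r = r} q-p r-p ℓr<ℓq with ℓ r ≤? ℓ (F q)
    ... | yes ℓ≤ℓ = ℓ≤ℓ
    ... | no  ℓ≰ℓ = ≤-reflexive (cong ℓ (between y₀∈F (y₀-ends q-p) r-p (<⇒≤ (≰⇒> ℓ≰ℓ))
                      (subst (_≤ length y₀) (length-shortest r) (proj₂ (proj₂ outside) _ r⊑q r∉q))))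
      where
      r⊑q : Suffix _≡_ (shortest r) (shortest q)
      r⊑q = shortest-⊑ r-p q-p (<⇒≤ ℓr<ℓq)
      r∉q : ¬ (shortest r ∈ˢ q)
      r∉q r∈q = <⇒≱ ℓr<ℓq (subst (ℓ q ≤_) (length-shortest r) (proj₂ (ℓ-def q) _ r∈q))

-- The number of states

least : {P : ℕ → Set} → (∀ p → Dec (P p)) → ∀ m → P m → ∃[ p ] (P p × (∀ {p′} → p′ < p → ¬ P p′))
least {P} P? = <-rec (λ m → P m → ∃[ p ] (P p × (∀ {p′} → p′ < p → ¬ P p′))) step
  where
  step : ∀ m → (∀ {m′} → m′ < m → P m′ → ∃[ p ] (P p × (∀ {p′} → p′ < p → ¬ P p′))) →
         P m → ∃[ p ] (P p × (∀ {p′} → p′ < p → ¬ P p′))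
  step m smaller Pm with anyUpTo? P? m
  ... | yes (m′ , m′<m , Pm′) = smaller m′<m Pm′
  ... | no  none              = m , Pm , λ p′<m Pp′ → none (_ , p′<m , Pp′)

module StateCount {A : Set} (_≟ᴬ_ : DecidableEquality A) {w : List A} (S : SuffixAutomaton w) where

  open SuffixAutomaton S
  open StateProperties _≟ᴬ_ S

  private variable
    q r c : State
    p p′ : ℕ

  ℓ<⇒≢initial : ℓ q < ℓ c → c ≢ initial
  ℓ<⇒≢initial {q} q<c c≡I = n≮0 (subst (ℓ q <_) (trans (cong ℓ c≡I) ℓ-initial) q<c)

  -- Suffix links followed from `c` cannot jump over `q`, by `F-greatest`; the last state before `q`
  -- is the child.
  child-towards : q endsAt p → c endsAt p → ℓ q < ℓ c → ∃[ c′ ] (c′ ≢ initial × c′ endsAt p × F c′ ≡ q)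
  child-towards {q} {p} {c₀} q-p c₀-p q<c₀ = climb (ℓ c₀) c₀ ≤-refl c₀-p q<c₀
    where
    climb : ∀ b c → ℓ c ≤ b → c endsAt p → ℓ q < ℓ c → ∃[ c′ ] (c′ ≢ initial × c′ endsAt p × F c′ ≡ q)
    climb zero    c ℓc≤0 c-p q<c = contradiction (<-≤-trans q<c ℓc≤0) n≮0
    climb (suc b) c ℓc≤b c-p q<c with m≤n⇒m<n∨m≡n (F-greatest (ℓ<⇒≢initial q<c) c-p q-p q<c)
    ... | inj₁ q<F = climb b (F c) (s≤s⁻¹ (≤-trans (ℓF< (ℓ<⇒≢initial q<c)) ℓc≤b)) (F-endsAt (ℓ<⇒≢initial q<c) c-p) q<F
    ... | inj₂ q≡F = c , ℓ<⇒≢initial q<c , c-p , endsAt-unique (F-endsAt (ℓ<⇒≢initial q<c) c-p) q-p (sym q≡F)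

  -- p is the first end position of q that is lost on passing to the child of
  -- q ending at POS q; such a p determines q.
  record Landmark (q : State) (p : ℕ) : Set where
    field
      child     : State
      child≢I   : child ≢ initial
      child-POS : child endsAt POS q
      F-child   : F child ≡ q
      q-ends    : q endsAt p
      lost      : ¬ (child endsAt p)
      kept      : ∀ {p′} → p′ < p → q endsAt p′ → child endsAt p′

  -- The child in `R` ends at `POS r` but not at `p`, so `POS r` is strictly before the first loss
  -- of `q`; and `q` ends at `POS r` because it lies below `r` in the chain at `p`.
  kept-at-POS : (Q : Landmark q p) → Landmark r p → ℓ q < ℓ r → Landmark.child Q endsAt POS r
  kept-at-POS {q} {p} {r} Q R q<r = kept Q a<p (endsAt-mono (q-ends Q) (q-ends R) (<⇒≤ q<r) endsAt-POS)
    where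
    open Landmark
    a<p : POS r < p
    a<p = ≤∧≢⇒< (POS≤ (q-ends R)) λ a≡p → lost R (subst (child R endsAt_) a≡p (child-POS R))

  -- At `POS r` both `r` and the child of `q` end. A child no longer than `r` would still end at
  -- `p`, where it is lost; a longer one would have `r` strictly between itself and its suffix link
  -- `q`.
  landmark-not-below : Landmark q p → Landmark r p → ¬ (ℓ q < ℓ r)
  landmark-not-below {r = r} Q R q<r with ≤-<-connex (ℓ (Landmark.child Q)) (ℓ r)
  ... | inj₁ c≤r = Landmark.lost Q (endsAt-mono (kept-at-POS Q R q<r) endsAt-POS c≤r (Landmark.q-ends R))
  ... | inj₂ r<c = <⇒≱ q<r (subst (ℓ r ≤_) (cong ℓ (Landmark.F-child Q))
                     (F-greatest (Landmark.child≢I Q) (kept-at-POS Q R q<r) endsAt-POS r<c))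

  landmark-injective : Landmark q p → Landmark r p → q ≡ r
  landmark-injective {q} {r = r} Q R with <-cmp (ℓ q) (ℓ r)
  ... | tri< q<r _ _ = contradiction q<r (landmark-not-below Q R)
  ... | tri≈ _ q≡r _ = endsAt-unique (Landmark.q-ends Q) (Landmark.q-ends R) q≡r
  ... | tri> _ _ r<q = contradiction r<q (landmark-not-below R Q)

  prefixState : ℕ → State
  prefixState zero    = initial
  prefixState (suc p) = T (suc p)

  -- Two labels for each of the positions 0, ..., |w|, whence the bound 2 (|w| + 1): one for a
  -- prefix state, one for a landmark.
  Code : State → Fin (suc (length w)) ⊎ Fin (suc (length w)) → Set
  Code q (inj₁ p) = prefixState (toℕ p) ≡ q
  Code q (inj₂ p) = Landmark q (toℕ p)

  code-injective : ∀ {a} → Code q a → Code r a → q ≡ r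
  code-injective {a = inj₁ _} Q R = trans (sym Q) R
  code-injective {a = inj₂ _} Q R = landmark-injective Q R

  -- Below the prefix state at `POS q` there is a child `c` of `q` on the way up. Its ending
  -- positions are among those of `q`; were none lost, `c` and `q` would be equal although
  -- `ℓ q < ℓ c`.
  landmark : ℓ q < ℓ (T (POS q)) → T (POS q) endsAt POS q → ∃[ p ] Landmark q p
  landmark {q = q} q<T T-a with child-towards (endsAt-POS {q}) T-a q<T
  ... | c , c≢I , c-a , Fc≡q = proj₁ found , record
    { child = c ; child≢I = c≢I ; child-POS = c-a ; F-child = Fc≡q
    ; q-ends = proj₁ lost-p ; lost = proj₂ lost-p
    ; kept = λ {p′} p′<p q-p′ → decidable-stable (endsAt? c p′) (λ c-∤ → first p′<p (q-p′ , c-∤))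
    }
    where
    Lost : ℕ → Set
    Lost p = q endsAt p × ¬ (c endsAt p)
    Lost? : ∀ p → Dec (Lost p)
    Lost? p = endsAt? q p ×-dec ¬? (endsAt? c p)
    q<c : ℓ q < ℓ c
    q<c = subst (_< ℓ c) (cong ℓ Fc≡q) (ℓF< c≢I)
    some-lost : ∃ Lost
    some-lost with anyUpTo? Lost? (suc (length w))
    ... | yes (p , _ , lost-p) = p , lost-p
    ... | no none = contradiction (cong ℓ q≡c) (<⇒≢ q<c)
      where
      q≡c : q ≡ c
      q≡c = endsAt-extensional
        (λ p q-p → decidable-stable (endsAt? c p) λ c-∤ → none (p , s≤s (proj₁ q-p) , q-p , c-∤))
        (λ p → endsAt-mono endsAt-POS c-a (<⇒≤ q<c))
    found : ∃[ p ] (Lost p × (∀ {p′} → p′ < p → ¬ Lost p′))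
    found = least Lost? (proj₁ some-lost) (proj₂ some-lost)
    lost-p = proj₁ (proj₂ found)
    first = proj₂ (proj₂ found)

  prefix-code : ∀ p → p ≤ length w → prefixState p ≡ q → ∃ (Code q)
  prefix-code {q} p p≤n eq = inj₁ p# , subst (λ m → prefixState m ≡ q) (sym (Fin.toℕ-fromℕ< (s≤s p≤n))) eq
    where
    p# : Fin (suc (length w))
    p# = fromℕ< (s≤s p≤n)

  landmark-code : ∀ p → Landmark q p → ∃ (Code q)
  landmark-code {q} p L = inj₂ p# , subst (Landmark q) (sym (Fin.toℕ-fromℕ< (s≤s p≤n))) L
    where
    p≤n : p ≤ length w
    p≤n = proj₁ (Landmark.q-ends L)
    p# : Fin (suc (length w))
    p# = fromℕ< (s≤s p≤n)

  encode-≢initial : q ≢ initial → ∃ (Code q)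
  encode-≢initial {q} q≢I = [ branching , prefix ]′ (m≤n⇒m<n∨m≡n (T-lowest a>0 (endsAt-POS {q})))
    where
    a>0 : 0 < POS q
    a>0 = POS>0 q≢I
    a≤n : POS q ≤ length w
    a≤n = proj₁ (endsAt-POS {q})
    T-a : T (POS q) endsAt POS q
    T-a = T-endsAt a>0 a≤n
    positive : ∀ {p} → 0 < p → prefixState p ≡ T p
    positive (s≤s _) = refl
    branching : ℓ q < ℓ (T (POS q)) → ∃ (Code q)
    branching q<T = uncurry landmark-code (landmark q<T T-a)
    prefix : ℓ q ≡ ℓ (T (POS q)) → ∃ (Code q)
    prefix q≡T = prefix-code (POS q) a≤n (trans (positive a>0) (endsAt-unique T-a endsAt-POS (sym q≡T)))

  encode : ∀ q → ∃ (Code q)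
  encode q = case q Fin.≟ initial of λ where
    (yes q≡I) → inj₁ zero , sym q≡I
    (no  q≢I) → encode-≢initial q≢I

  size≤ : size ≤ suc (length w) + suc (length w)
  size≤ = Fin.injective⇒≤ {f = join _ _ ∘ proj₁ ∘ encode} injective
    where
    injective : Injective _≡_ _≡_ (join (suc (length w)) (suc (length w)) ∘ proj₁ ∘ encode)
    injective {q} {r} eq = code-injective (proj₂ (encode q)) (subst (Code r) (sym codes≡) (proj₂ (encode r)))
      where
      codes≡ : proj₁ (encode q) ≡ proj₁ (encode r)
      codes≡ = trans (sym (Fin.splitAt-join _ _ (proj₁ (encode q))))
                 (trans (cong (splitAt (suc (length w))) eq) (Fin.splitAt-join _ _ (proj₁ (encode r))))

-- Counting the elements of a decidable predicate

module _ {m : ℕ} where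

  private variable
    P Q : Fin m → Set

  subset : (∀ q → Dec (P q)) → Subset m
  subset P? = tabulate (does ∘ P?)

  ∈-subset⁺ : (P? : ∀ q → Dec (P q)) → ∀ {q} → P q → q Subset.∈ subset P?
  ∈-subset⁺ P? {q} Pq =
    Vec.lookup⇒[]= q _ (trans (Vec.lookup∘tabulate (does ∘ P?) q) (dec-true (P? q) Pq))

  does-true : {B : Set} (B? : Dec B) → does B? ≡ true → B
  does-true (yes b) _ = b

  ∈-subset⁻ : (P? : ∀ q → Dec (P q)) → ∀ {q} → q Subset.∈ subset P? → P q
  ∈-subset⁻ P? {q} q∈ =
    does-true (P? q) (trans (sym (Vec.lookup∘tabulate (does ∘ P?) q)) (Vec.[]=⇒lookup q∈))

  count : (∀ q → Dec (P q)) → ℕ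
  count = card ∘ subset

  count≤ : (P? : ∀ q → Dec (P q)) → count P? ≤ m
  count≤ = Subset.∣p∣≤n ∘ subset

  count-mono : (P? : ∀ q → Dec (P q)) (Q? : ∀ q → Dec (Q q)) → (∀ q → P q → Q q) → count P? ≤ count Q?
  count-mono P? Q? P⇒Q = Subset.p⊆q⇒∣p∣≤∣q∣ (∈-subset⁺ Q? ∘ P⇒Q _ ∘ ∈-subset⁻ P?)

  count-strict : (P? : ∀ q → Dec (P q)) (Q? : ∀ q → Dec (Q q)) → (∀ q → P q → Q q) →
                 ∀ q → Q q → ¬ P q → count P? < count Q?
  count-strict P? Q? P⇒Q q Qq ¬Pq = Subset.p⊂q⇒∣p∣<∣q∣
    ((∈-subset⁺ Q? ∘ P⇒Q _ ∘ ∈-subset⁻ P?) , q , ∈-subset⁺ Q? Qq , ¬Pq ∘ ∈-subset⁻ P?)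

-- Program logic with time credits

module Credit {A : Set} {w : List A} (S : SuffixAutomaton w) where

  open SuffixAutomaton S using (size)
  open Algorithm S hiding (i; j; k; e; q)

  Post : (Store → ℕ → Set) → (Store → Set) → Outcome → Store → ℕ → Set
  Post N R normal   s κ = N s κ
  Post N R returned s κ = R s

  -- Total correctness with κ units of time available: N speaks of the store and
  -- of the time left on normal termination, R of the store on return.
  record WP (c : Cmd) (N : Store → ℕ → Set) (R : Store → Set) (s : Store) (κ : ℕ) : Set where
    constructor wp
    field
      {outcome} : Outcome
      {store}   : Store
      {time left} : ℕ
      run       : ⟨ c , s ⟩⇓⟨ outcome , store ⟩ time
      within    : time + left ≤ κ
      post      : Post N R outcome store left

  private variable
    b : Test
    c c₁ c₂ : Cmd
    a : Instr
    N N′ : Store → ℕ → Set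
    R : Store → Set
    s : Store
    κ κ′ : ℕ

  holds? : ∀ b s → Dec (Holds b s)
  holds? (a ≤′ b)  s = eval a s ≤? eval b s
  holds? (a <′ b)  s = eval a s <? eval b s
  holds? (a ≤ᵈ b)  s = ≤⁺-dec _≤?_ (eval a s) (eval b s)
  holds? (a <ᵈ b)  s = <⁺-dec _<?_ (eval a s) (eval b s)
  holds? (a ≡′ b)  s = eval a s ≟ eval b s
  holds? (a ≢′ b)  s = ¬? (eval a s Fin.≟ eval b s)
  holds? (b and c) s = holds? b s ×-dec holds? c s

  testCost>0 : ∀ b → 0 < testCost b
  testCost>0 (_ ≤′ _)  = s≤s z≤n
  testCost>0 (_ <′ _)  = s≤s z≤n
  testCost>0 (_ ≤ᵈ _)  = s≤s z≤n
  testCost>0 (_ <ᵈ _)  = s≤s z≤n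
  testCost>0 (_ ≡′ _)  = s≤s z≤n
  testCost>0 (_ ≢′ _)  = s≤s z≤n
  testCost>0 (_ and _) = s≤s z≤n

  wp-weaken : κ ≤ κ′ → WP c N R s κ → WP c N R s κ′
  wp-weaken κ≤κ′ (wp r t≤ p) = wp r (≤-trans t≤ κ≤κ′) p

  wp-mono : (∀ s κ → N s κ → N′ s κ) → WP c N R s κ → WP c N′ R s κ
  wp-mono N⇒N′ (wp {normal}   r t≤ p) = wp r t≤ (N⇒N′ _ _ p)
  wp-mono N⇒N′ (wp {returned} r t≤ p) = wp r t≤ p

  wp-do : N (perform a s) κ → WP (do! a) N R s (instrCost a + κ)
  wp-do n = wp do! ≤-refl n

  spend : ∀ t {t′ l l′} → t + l ≤ κ → t′ + l′ ≤ l → t + t′ + l′ ≤ κ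
  spend {κ} t {t′} {l} {l′} t+l t′+l′ = begin
    t + t′ + l′   ≡⟨ +-assoc t t′ l′ ⟩
    t + (t′ + l′) ≤⟨ +-monoʳ-≤ t t′+l′ ⟩
    t + l         ≤⟨ t+l ⟩
    κ             ∎
    where open ≤-Reasoning

  wp-seq : WP c₁ (WP c₂ N R) R s κ → WP (c₁ ⨾ c₂) N R s κ
  wp-seq (wp {normal} {time = t} r₁ t≤ (wp {o} r₂ t′≤ p)) = wp (seq r₁ r₂) (spend t t≤ t′≤) p
  wp-seq (wp {returned} r₁ t≤ p) = wp (seq-returned r₁) t≤ p

  wp-if : (Holds b s → WP c N R s κ) → (¬ Holds b s → N s κ) → WP (if b then c) N R s (testCost b + κ)
  wp-if {b = b} {s = s} on-true on-false with holds? b s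
  ... | no ¬h = wp (if-false ¬h) ≤-refl (on-false ¬h)
  ... | yes h with on-true h
  ...   | wp {time = t} r t≤ p = wp (if-true h r) (spend (testCost b) {t} ≤-refl t≤) p

  wp-return : R s → WP return N R s (suc κ)
  wp-return r = wp return ≤-refl r

  -- Credit doubles as the termination measure: every test costs at least one unit, so the credit
  -- drops on each pass and bounds the recursion.
  wp-while : (Inv : Store → ℕ → Set) →
    (∀ s κ → Inv s κ → Holds b s   → ∃[ κ′ ] (testCost b + κ′ ≤ κ × WP c Inv R s κ′)) →
    (∀ s κ → Inv s κ → ¬ Holds b s → ∃[ κ′ ] (testCost b + κ′ ≤ κ × N s κ′)) →
    Inv s κ → WP (while b repeat c) N R s κ
  wp-while {b} {c} {R} {N} Inv body exit = loop _ _ _ ≤-refl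
    where
    loop : ∀ fuel s κ → κ ≤ fuel → Inv s κ → WP (while b repeat c) N R s κ
    loop fuel s κ κ≤ inv with holds? b s
    loop fuel s κ κ≤ inv | no ¬h with exit s κ inv ¬h
    ... | κ′ , t≤ , n = wp (while-false ¬h) t≤ n
    loop zero s κ κ≤ inv | yes h with body s κ inv h
    ... | κ′ , t≤ , _ =
      contradiction (≤-trans (testCost>0 b) (≤-trans (m≤m+n _ κ′) (≤-trans t≤ κ≤))) n≮0
    loop (suc fuel) s κ κ≤ inv | yes h with body s κ inv h
    ... | κ′ , t≤ , wp {returned} {time = t} r t′≤ p =
      wp (while-returned h r) (spend (testCost b) {t} t≤ t′≤) p
    ... | κ′ , t≤ , wp {normal} {s′} {t} {l} r t′≤ inv′ with loop fuel s′ l l≤fuel inv′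
      where
      l≤fuel : l ≤ fuel
      l≤fuel = s≤s⁻¹ (begin
        suc l           ≤⟨ +-mono-≤ (testCost>0 b) (≤-trans (m≤n+m l t) t′≤) ⟩
        testCost b + κ′ ≤⟨ t≤ ⟩
        κ               ≤⟨ κ≤ ⟩
        suc fuel        ∎)
        where open ≤-Reasoning
    ... | wp {time = t″} r′ t″≤ p =
      wp (while-true h r r′) (spend (testCost b + t) {t″} (spend (testCost b) {t} t≤ t′≤) t″≤) p

-- Extended naturals and insertion

≮⁺⇒≥⁺ : ∀ {m : ℕ} {x : ℕ ⁺} → ¬ ([ m ] <⁺ x) → x ≤⁺ [ m ]
≮⁺⇒≥⁺ {x = [ _ ]} m≮x = [ ≮⇒≥ (m≮x ∘ [_]) ]
≮⁺⇒≥⁺ {x = ⊤⁺}   m≮x = contradiction [ _ ]<⊤⁺ m≮x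

≰⁺⇒>⁺ : ∀ {m : ℕ} {x : ℕ ⁺} → ¬ ([ m ] ≤⁺ x) → x <⁺ [ m ]
≰⁺⇒>⁺ {x = [ _ ]} m≰x = [ ≰⇒> (m≰x ∘ [_]) ]
≰⁺⇒>⁺ {x = ⊤⁺}   m≰x = contradiction (_ ≤⊤⁺) m≰x

<⁺⇒≤⁺ : ∀ {m : ℕ} {x : ℕ ⁺} → [ m ] <⁺ x → [ m ] ≤⁺ x
<⁺⇒≤⁺ [ m<x ]    = [ <⇒≤ m<x ]
<⁺⇒≤⁺ [ _ ]<⊤⁺ = _ ≤⊤⁺

-- Rounds move leftwards, so each new position is smaller than those in `P`. Insertion then really
-- lengthens the list, which makes `length P` count the rounds.
insert-fresh : ∀ {m P} → All (m <_) P → insert m P ≡ m ∷ P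
insert-fresh {m} {P} m<P with mem? _≟_ m P
... | yes m∈P = contradiction (All.lookup m<P m∈P) (<-irrefl refl)
... | no  _   = refl

-- Invariants of the main loop

module Invariants {A : Set} (_≟ᴬ_ : DecidableEquality A) {w : List A} (S : SuffixAutomaton w) where

  open SuffixAutomaton S
  open StateProperties _≟ᴬ_ S
  open Algorithm S using (Store)

  Distances : Set
  Distances = Vec (ℕ ⁺) size

  infix 4 _⊑_
  record _⊑_ (d′ d : Distances) : Set where
    constructor pointwise
    field at : ∀ q → lookup d′ q ≤⁺ lookup d q

  open _⊑_ public

  Short : Distances → State → Set
  Short d q = lookup d q <⁺ [ ℓ q ]

  -- The occurrence of the shortest word of `q` ending at `p` starts at `p - ℓ q + 1`; the
  -- inequalities say that it contains `t`. Longer words of `q` ending at `p` then contain `t` too.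
  Covered : List ℕ → State → Set
  Covered P q = ∃₂ λ p t → q endsAt p × t ∈ P × t ≤ p × p < t + ℓ q

  -- `initial` is excluded because walks stop there, leaving its entry infinite.
  Reached : Distances → ℕ → ℕ → Set
  Reached d p m = ∀ r → r ≢ initial → r endsAt p → lookup d r ≤⁺ [ m ]

  -- Besides witnessing the value m of d at q, p has all the states ending there
  -- at distance at most m: a walk along suffix links may thus stop at q.
  Justified : Distances → List ℕ → State → ℕ → Set
  Justified d P q m = ∃₂ λ p t → q endsAt p × t ∈ P × p ≡ t + m × Reached d p m

  Sound : Distances → List ℕ → Set
  Sound d P = ∀ q m → lookup d q ≡ [ m ] → Justified d P q m

  Positions : List ℕ → Set
  Positions P = All (λ t → 1 ≤ t × t ≤ length w) P

  -- `checked` starts with `initial`, whose `ℓ` is 0, so that no position can cover it.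
  Marked : Subset size → List ℕ → Set
  Marked c P = ∀ q → q Subset.∈ c → q ≢ initial → Covered P q

  private variable
    d d′ : Distances
    P P′ : List ℕ
    q r  : State
    m p : ℕ

  short-⊑ : d′ ⊑ d → Short d q → Short d′ q
  short-⊑ d′⊑d = <⁺-transʳ ≤-<-trans (at d′⊑d _)

  reached-⊑ : d′ ⊑ d → Reached d p m → Reached d′ p m
  reached-⊑ d′⊑d reached r r≢I r-p = ≤⁺-trans ≤-trans (at d′⊑d r) (reached r r≢I r-p)

  justified-⊑ : d′ ⊑ d → Justified d P q m → Justified d′ P q m
  justified-⊑ d′⊑d (p , t , q-p , t∈P , p≡ , reached) = p , t , q-p , t∈P , p≡ , reached-⊑ d′⊑d reached

  covered-⊆ : (∀ {t} → t ∈ P → t ∈ P′) → Covered P q → Covered P′ q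
  covered-⊆ P⊆P′ (p , t , q-p , t∈P , t≤p , p<) = p , t , q-p , P⊆P′ t∈P , t≤p , p<

  justified-⊆ : (∀ {t} → t ∈ P → t ∈ P′) → Justified d P q m → Justified d P′ q m
  justified-⊆ P⊆P′ (p , t , q-p , t∈P , rest) = p , t , q-p , P⊆P′ t∈P , rest

  short⇒covered : Sound d P → Short d q → Covered P q
  short⇒covered {d} {q = q} sound short with lookup d q in eq
  short⇒covered {q = q} sound [ m<ℓ ] | [ m ] with sound q m eq
  ... | p , t , q-p , t∈P , refl , _ = p , t , q-p , t∈P , m≤m+n t m , +-monoʳ-< t m<ℓ

  decrease-⊑ : [ m ] <⁺ lookup d q → d [ q ]≔ [ m ] ⊑ d
  decrease-⊑ {m} {d} {q} m<d = pointwise λ r → case r Fin.≟ q of λ where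
    (yes refl) → subst (_≤⁺ lookup d q) (sym (Vec.lookup∘update q d [ m ])) (<⁺⇒≤⁺ m<d)
    (no r≢q)   → ≤⁺-reflexive-≡ ≤-reflexive (Vec.lookup∘update′ r≢q d [ m ])

  -- `J` drives the recursion over rounds and `L` is the number of positions chosen so far. At `j` =
  -- 0, `ready` speaks of every state other than `initial`, since their `POS` is positive.
  record Round (J L j : ℕ) (d : Distances) (P : List ℕ) (c : Subset size) : Set where
    field
      j≤J       : j ≤ J
      j≤n       : j ≤ length w
      fresh     : All (j <_) P
      |P|       : length P ≡ L
      positions : Positions P
      sound     : Sound d P
      marked    : Marked c P
      ready     : ∀ q → q ≢ initial → j < POS q → Short d q

  RoundAt : ℕ → ℕ → Store → Set
  RoundAt J L s = Round J L (Store.j s) (Store.d s) (Store.P s) (Store.checked s)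

  -- The second alternative puts `k` at or after the start of the first occurrence of the shortest
  -- word of `q`; once `k ≤ POS q`, that occurrence contains `k`. Raising `k` preserves it.
  Stacked : Distances → ℕ → ℕ → ℕ → Set
  Stacked d k i j = ∀ q → i < POS q → POS q ≤ j → Short d q ⊎ POS q < k + ℓ q

  -- Gathers what survives lowering entries of `d` (see `added-⊑`). Soundness is kept apart because
  -- a walk suspends it.
  record Added (J L k j : ℕ) (d : Distances) (P : List ℕ) (c : Subset size) : Set where
    field
      1≤k       : 1 ≤ k
      k≤j       : k ≤ j
      j≤J       : j ≤ J
      j≤n       : j ≤ length w
      k≤P       : All (k ≤_) P
      k∈P       : k ∈ P
      |P|       : length P ≡ suc L
      positions : Positions P
      marked    : Marked c P
      ready     : ∀ q → q ≢ initial → j < POS q → Short d q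
      stacked   : ∀ q → k ≤ POS q → POS q ≤ j → Short d q ⊎ POS q < k + ℓ q

  AddedAt : ℕ → ℕ → Store → Set
  AddedAt J L s = Added J L (Store.k s) (Store.j s) (Store.d s) (Store.P s) (Store.checked s)

  added-⊑ : ∀ {J L k j c c′} → d′ ⊑ d → Marked c′ P → Added J L k j d P c → Added J L k j d′ P c′
  added-⊑ d′⊑d marked′ a = record
    { 1≤k = 1≤k ; k≤j = k≤j ; j≤J = j≤J ; j≤n = j≤n ; k≤P = k≤P ; k∈P = k∈P ; |P| = |P|
    ; positions = positions ; marked = marked′
    ; ready = λ q q≢I j< → short-⊑ d′⊑d (ready q q≢I j<)
    ; stacked = λ q k≤ ≤j → Sum.map₁ (short-⊑ d′⊑d) (stacked q k≤ ≤j)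
    }
    where open Added a

  Solved : ℕ → Store → Set
  Solved L s = length (Store.P s) ≡ L × Positions (Store.P s) × (∀ q → q ≢ initial → Covered (Store.P s) q)

  F-or-self : q ≢ initial → q endsAt p → r endsAt p → ℓ (F q) < ℓ r → ℓ q < ℓ r ⊎ r ≡ q
  F-or-self {q} {r = r} q≢I q-p r-p F<r with ≤-<-connex (ℓ r) (ℓ q)
  ... | inj₂ q<r = inj₁ q<r
  ... | inj₁ r≤q = inj₂ (endsAt-unique r-p q-p (case m≤n⇒m<n∨m≡n r≤q of λ where
    (inj₁ r<q) → contradiction F<r (≤⇒≯ (F-greatest q≢I q-p r-p r<q))
    (inj₂ r≡q) → r≡q))

-- The stacking phase

module StackingAnalysis {A : Set} (_≟ᴬ_ : DecidableEquality A) {w : List A} (S : SuffixAutomaton w) where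

  open SuffixAutomaton S
  open StateProperties _≟ᴬ_ S
  open Algorithm S renaming (i to #i; j to #j; k to #k; e to #e; q to #q)
  open Credit S
  open Invariants _≟ᴬ_ S

  firstBy? : ∀ p q → Dec (POS q ≤ p)
  firstBy? p q = POS q ≤? p

  -- The potential of the inner loop: states first ending further left, and those first ending here
  -- that the walk has not passed.
  Remaining : ℕ → State → State → Set
  Remaining p q r = POS r < p ⊎ (POS r ≡ p × ℓ r ≤ ℓ q)

  remaining? : ∀ p q r → Dec (Remaining p q r)
  remaining? p q r = (POS r <? p) ⊎-dec ((POS r ≟ p) ×-dec (ℓ r ≤? ℓ q))

  module _ (J L rest : ℕ) where

    -- In the credits, 30 covers one pass through the body of either loop: an inner
    -- pass removes q from the counted states, an outer one moves i.
    record Outer (s : Store) (κ : ℕ) : Set where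
      open Store s
      field
        round   : RoundAt J L s
        1≤k     : 1 ≤ k
        k≤j     : k ≤ j
        k≤1+i   : k ≤ suc i
        i≤j     : i ≤ j
        stacked : Stacked d k i j
        credit  : count (firstBy? i) * 30 + (i * 30 + (3 + rest)) ≤ κ

    record Inner (s : Store) (κ : ℕ) : Set where
      open Store s
      field
        round   : RoundAt J L s
        1≤k     : 1 ≤ k
        k≤i     : k ≤ i
        i≤j     : i ≤ j
        stacked : Stacked d k i j
        q-ends  : q endsAt i
        visited : ∀ r → POS r ≡ i → ℓ q < ℓ r → Short d r ⊎ i < k + ℓ r
        -- The 8 pays for the failing inner test (4) and the decrement of `i` (4), the 3 for the
        -- last failing outer test.
        credit  : count (remaining? i q) * 30 + (8 + ((i ∸ 1) * 30 + (3 + rest))) ≤ κ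

    record Done (s : Store) (κ : ℕ) : Set where
      open Store s
      field
        round   : RoundAt J L s
        1≤k     : 1 ≤ k
        k≤j     : k ≤ j
        stacked : ∀ q → k ≤ POS q → POS q ≤ j → Short d q ⊎ POS q < k + ℓ q
        credit  : rest ≤ κ

    module _ {s : Store} {κ : ℕ} (inv : Inner s κ) (POS≡i : POS (Store.q s) ≡ Store.i s) where

      open Store s
      open Inner inv

      private
        tail = 8 + ((i ∸ 1) * 30 + (3 + rest))
        m₁ = count (remaining? i (F q))

        -- `i` is positive while `POS initial` is 0, so the loop test alone keeps the walk off
        -- `initial`.
        q≢I : q ≢ initial
        q≢I refl = n≮0 (subst (1 ≤_) (trans (sym POS≡i) POS-initial) (≤-trans 1≤k k≤i))

        fewer : m₁ < count (remaining? i q)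
        fewer = count-strict (remaining? i (F q)) (remaining? i q)
          (λ r → Sum.map₂ (map₂ (λ r≤F → ≤-trans r≤F (<⇒≤ (ℓF< q≢I)))))
          q (inj₂ (POS≡i , ≤-refl)) λ where
            (inj₁ POS<i)     → <-irrefl POS≡i POS<i
            (inj₂ (_ , q≤F)) → <⇒≱ (ℓF< q≢I) q≤F

        advance : ∀ k′ → k ≤ k′ → k′ ≤ i → Short d q ⊎ i < k′ + ℓ q →
                  WP (do! (#q ≔ F[ var #q ])) Inner (Solved (suc L)) (record s { k = k′ }) (3 + (m₁ * 30 + tail))
        advance k′ k≤k′ k′≤i visited-q = wp-do (record
          { round = round ; 1≤k = ≤-trans 1≤k k≤k′ ; k≤i = k′≤i ; i≤j = i≤j
          ; stacked = λ r i< ≤j → Sum.map₂ grow (stacked r i< ≤j)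
          ; q-ends = F-endsAt q≢I q-ends
          ; visited = λ r POSr≡i F<r →
              case F-or-self q≢I q-ends (subst (r endsAt_) POSr≡i endsAt-POS) F<r of λ where
                (inj₁ q<r)  → Sum.map₂ grow (visited r POSr≡i q<r)
                (inj₂ refl) → visited-q
          ; credit = ≤-refl
          })
          where
          grow : ∀ {x y} → x < k + y → x < k′ + y
          grow x< = <-≤-trans x< (+-monoˡ-≤ _ k≤k′)

        start≤i : (i ∸ ℓ q) + 1 ≤ i
        start≤i = subst (_≤ i) (+-comm 1 (i ∸ ℓ q)) (∸-monoʳ-< {i} (ℓ>0 q≢I) (ℓ≤ q-ends))

        i<start+ℓ : ∀ k′ → (i ∸ ℓ q) + 1 ≤ k′ → i < k′ + ℓ q
        i<start+ℓ k′ start≤k′ = begin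
          suc i                   ≡⟨ cong suc (m∸n+n≡m (ℓ≤ q-ends)) ⟨
          suc (i ∸ ℓ q) + ℓ q     ≡⟨ cong (_+ ℓ q) (+-comm 1 (i ∸ ℓ q)) ⟩
          ((i ∸ ℓ q) + 1) + ℓ q   ≤⟨ +-monoˡ-≤ (ℓ q) start≤k′ ⟩
          k′ + ℓ q                ∎
          where open ≤-Reasoning

      inner-body : ∃[ κ′ ] (4 + κ′ ≤ κ × WP
        ((if fin ℓ[ var #q ] ≤ᵈ d[ var #q ] then
            do! (#k ≔ max (var #k) (var #i ⊖ ℓ[ var #q ] ⊕ lit 1))) ⨾
         do! (#q ≔ F[ var #q ])) Inner (Solved (suc L)) s κ′)
      inner-body = 26 + (m₁ * 30 + tail) , ≤-trans (+-monoˡ-≤ tail (*-monoˡ-≤ 30 fewer)) credit ,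
        wp-seq (wp-if
          (λ _ → wp-do (wp-weaken (m≤n+m _ 8) (advance _ (m≤m⊔n k _) (⊔-lub k≤i start≤i)
                   (inj₂ (i<start+ℓ _ (m≤n⊔m k _))))))
          (λ ℓ≰d → wp-weaken (m≤n+m _ 17) (advance k ≤-refl k≤i (inj₁ (≰⁺⇒>⁺ ℓ≰d)))))

    -- Stopping at `q` misses nothing: a state at or below `q` in the chain also ends at `POS q`,
    -- which is less than `i`, so `i` is not its first ending position.
    inner-exit : ∀ {s κ} → Inner s κ → POS (Store.q s) ≢ Store.i s →
                 ∃[ κ′ ] (4 + κ′ ≤ κ × WP (do! (#i ≔ var #i ⊖ lit 1)) Outer (Solved (suc L)) s κ′)
    inner-exit {s} {κ} inv POS≢i = 4 + (count (firstBy? (i ∸ 1)) * 30 + ((i ∸ 1) * 30 + (3 + rest))) , enough ,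
      wp-do (record
        { round = round ; 1≤k = 1≤k ; k≤j = ≤-trans k≤i i≤j
        ; k≤1+i = subst (k ≤_) i≡ k≤i
        ; i≤j = ≤-trans (m∸n≤m i 1) i≤j
        ; stacked = λ r i∸1<r r≤j → case m≤n⇒m<n∨m≡n (subst (_≤ POS r) (sym i≡) i∸1<r) of λ where
            (inj₁ i<r) → stacked r i<r r≤j
            (inj₂ i≡r) → subst (λ x → Short d r ⊎ x < k + ℓ r) i≡r (visited r (sym i≡r) (longer r (sym i≡r)))
        ; credit = ≤-refl
        })
      where
      open Store s
      open Inner inv
      1≤i : 1 ≤ i
      1≤i = ≤-trans 1≤k k≤i
      i≡ : i ≡ suc (i ∸ 1)
      i≡ = sym (m+[n∸m]≡n 1≤i)
      longer : ∀ r → POS r ≡ i → ℓ q < ℓ r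
      longer r POSr≡i = ≰⇒> λ r≤q → POS≢i (≤-antisym (POS≤ q-ends)
        (subst (_≤ POS q) POSr≡i (POS≤ (endsAt-mono r-i q-ends r≤q endsAt-POS))))
        where
        r-i : r endsAt i
        r-i = subst (r endsAt_) POSr≡i endsAt-POS
      fewer : count (firstBy? (i ∸ 1)) ≤ count (remaining? i q)
      fewer = count-mono (firstBy? (i ∸ 1)) (remaining? i q) λ r r≤ → inj₁ (subst (POS r <_) (sym i≡) (s≤s r≤))
      enough : 8 + (count (firstBy? (i ∸ 1)) * 30 + ((i ∸ 1) * 30 + (3 + rest))) ≤ κ
      enough = begin
        8 + (x * 30 + y)                                  ≡⟨ +-assoc 8 (x * 30) y ⟨
        8 + x * 30 + y                                    ≡⟨ cong (_+ y) (+-comm 8 (x * 30)) ⟩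
        x * 30 + 8 + y                                    ≡⟨ +-assoc (x * 30) 8 y ⟩
        x * 30 + (8 + y)                                  ≤⟨ +-monoˡ-≤ (8 + y) (*-monoˡ-≤ 30 fewer) ⟩
        count (remaining? i q) * 30 + (8 + y)             ≤⟨ credit ⟩
        κ                                                 ∎
        where
        open ≤-Reasoning
        x = count (firstBy? (i ∸ 1))
        y = (i ∸ 1) * 30 + (3 + rest)

    outer-body : ∀ {s κ} → Outer s κ → Store.k s ≤ Store.i s →
      ∃[ κ′ ] (3 + κ′ ≤ κ × WP
        (do! (#q ≔ T[ var #i ]) ⨾
         (while POS[ var #q ] ≡′ var #i repeat
           ( (if fin ℓ[ var #q ] ≤ᵈ d[ var #q ] then
                do! (#k ≔ max (var #k) (var #i ⊖ ℓ[ var #q ] ⊕ lit 1))) ⨾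
             do! (#q ≔ F[ var #q ]))) ⨾
         do! (#i ≔ var #i ⊖ lit 1)) Outer (Solved (suc L)) s κ′)
    outer-body {s} {κ} inv k≤i = 27 + (x * 30 + y) , enough ,
      wp-seq (wp-do (wp-seq (wp-while Inner (λ _ _ → inner-body) (λ _ _ → inner-exit) (record
        { round = round ; 1≤k = 1≤k ; k≤i = k≤i ; i≤j = i≤j ; stacked = stacked
        ; q-ends = T-endsAt 1≤i (≤-trans i≤j (Round.j≤n round))
        ; visited = λ r POSr≡i T<r →
            contradiction T<r (≤⇒≯ (T-lowest 1≤i (subst (r endsAt_) POSr≡i endsAt-POS)))
        ; credit = begin
            count (remaining? i (T i)) * 30 + (8 + y) ≤⟨ +-monoˡ-≤ (8 + y) (*-monoˡ-≤ 30 fewer) ⟩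
            x * 30 + (8 + y)                          ≡⟨ +-assoc (x * 30) 8 y ⟨
            x * 30 + 8 + y                            ≡⟨ cong (_+ y) (+-comm (x * 30) 8) ⟩
            8 + (x * 30 + y)                          ≤⟨ m≤n+m _ 16 ⟩
            24 + (x * 30 + y)                         ∎
        }))))
      where
      open Store s
      open Outer inv
      open ≤-Reasoning
      x = count (firstBy? i)
      y = (i ∸ 1) * 30 + (3 + rest)
      1≤i : 1 ≤ i
      1≤i = ≤-trans 1≤k k≤i
      fewer : count (remaining? i (T i)) ≤ x
      fewer = count-mono (remaining? i (T i)) (firstBy? i) λ where
        r (inj₁ r<i)       → <⇒≤ r<i
        r (inj₂ (r≡i , _)) → ≤-reflexive r≡i
      enough : 30 + (x * 30 + y) ≤ κ
      enough = begin
        30 + (x * 30 + y)                     ≡⟨ +-assoc 30 (x * 30) y ⟨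
        30 + x * 30 + y                       ≡⟨ cong (_+ y) (+-comm 30 (x * 30)) ⟩
        x * 30 + 30 + y                       ≡⟨ +-assoc (x * 30) 30 y ⟩
        x * 30 + (suc (i ∸ 1) * 30 + (3 + rest)) ≡⟨ cong (λ p → x * 30 + (p * 30 + (3 + rest))) (m+[n∸m]≡n 1≤i) ⟩
        x * 30 + (i * 30 + (3 + rest))        ≤⟨ credit ⟩
        κ                                     ∎

    outer-exit : ∀ {s κ} → Outer s κ → ¬ (Store.k s ≤ Store.i s) → ∃[ κ′ ] (3 + κ′ ≤ κ × Done s κ′)
    outer-exit {s} inv k≰i = rest , enough , record
      { round = round ; 1≤k = 1≤k ; k≤j = k≤j
      ; stacked = λ q k≤q → stacked q (<-≤-trans (≰⇒> k≰i) k≤q) ; credit = ≤-refl }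
      where
      open Store s
      open Outer inv
      enough : 3 + rest ≤ _
      enough = ≤-trans (≤-trans (m≤n+m (3 + rest) (i * 30)) (m≤n+m _ (count (firstBy? i) * 30))) credit

    stacking-wp : ∀ {s} → RoundAt J L s → 1 ≤ Store.j s →
                  WP stacking Done (Solved (suc L)) s (4 + (size * 30 + (Store.j s * 30 + (3 + rest))))
    stacking-wp {s} round 1≤j =
      wp-seq (wp-do (wp-seq (wp-do (wp-while Outer (λ _ _ → outer-body) (λ _ _ → outer-exit) (record
        { round = round ; 1≤k = ≤-refl ; k≤j = 1≤j ; k≤1+i = s≤s z≤n ; i≤j = ≤-refl
        ; stacked = λ q j<q q≤j → contradiction q≤j (<⇒≱ j<q)
        ; credit = +-monoˡ-≤ _ (*-monoˡ-≤ 30 (count≤ (firstBy? (Store.j s))))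
        })))))

-- The updating phase

module UpdatingAnalysis {A : Set} (_≟ᴬ_ : DecidableEquality A) {w : List A} (S : SuffixAutomaton w) where

  open SuffixAutomaton S
  open StateProperties _≟ᴬ_ S
  open Algorithm S renaming (i to #i; j to #j; k to #k; e to #e; q to #q)
  open Credit S
  open Invariants _≟ᴬ_ S

  -- The potential of this phase: lowering `d[q]` to the current distance removes `q` from the
  -- count, and a larger distance at the next `i` never brings a state back.
  farther? : ∀ m (d : Distances) q → Dec ([ m ] <⁺ lookup d q)
  farther? m d q = <⁺-dec _<?_ [ m ] (lookup d q)

  module _ (J L rest : ℕ) where

    -- States above the current one in the chain at `i` whose entry was set by the walk in progress.
    -- They cannot be `Justified` by `i` before the chain below is known to be reached.
    Pending : Store → State → ℕ → Set
    Pending s r m = ℓ (Store.q s) < ℓ r × r endsAt Store.i s × m ≡ Store.e s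

    record Outer (s : Store) (κ : ℕ) : Set where
      open Store s
      field
        added     : AddedAt J L s
        k≤i       : k ≤ i
        i≤1+j     : i ≤ suc j
        sound     : Sound d P
        processed : ∀ p → k ≤ p → p < i → Reached d p (p ∸ k)
        credit    : count (farther? (i ∸ k) d) * 30 + ((suc j ∸ i) * 30 + (3 + rest)) ≤ κ

    record Inner (s : Store) (κ : ℕ) : Set where
      open Store s
      field
        added     : AddedAt J L s
        k≤i       : k ≤ i
        i≤j       : i ≤ j
        e≡i∸k     : e ≡ i ∸ k
        q-ends    : q endsAt i
        sound     : ∀ r m → lookup d r ≡ [ m ] → Justified d P r m ⊎ Pending s r m
        processed : ∀ p → k ≤ p → p < i → Reached d p (p ∸ k)
        walked    : ∀ r → r endsAt i → ℓ q < ℓ r → lookup d r ≤⁺ [ e ]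
        -- The 13 pays for the failing inner test (9) and the increment of `i` (4). The dearest
        -- inner pass, one that inserts into `checked` and goes on, costs 27, so 30 suffices.
        credit    : count (farther? e d) * 30 + (13 + ((j ∸ i) * 30 + (3 + rest))) ≤ κ

    record Done (s : Store) (κ : ℕ) : Set where
      open Store s
      field
        added     : AddedAt J L s
        sound     : Sound d P
        processed : ∀ p → k ≤ p → p ≤ j → Reached d p (p ∸ k)
        credit    : rest ≤ κ

    module _ {s : Store} {κ : ℕ} (inv : Inner s κ)
             (q≢I : Store.q s ≢ initial) (e<d : [ Store.e s ] <⁺ lookup (Store.d s) (Store.q s)) where

      open Store s
      open Inner inv
      open Added added

      private
        d′ = d [ q ]≔ [ e ]
        d′⊑d = decrease-⊑ {d = d} e<d
        tail = 13 + ((j ∸ i) * 30 + (3 + rest))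
        m₁ = count (farther? e d′)

        d′q≡e : lookup d′ q ≡ [ e ]
        d′q≡e = Vec.lookup∘update q d [ e ]

        fewer : m₁ < count (farther? e d)
        fewer = count-strict (farther? e d′) (farther? e d)
          (λ r e<d′ → <⁺-transˡ <-≤-trans e<d′ (at d′⊑d r)) q e<d
          (λ e<d′ → <-irrefl refl ([<]-injective (subst ([ e ] <⁺_) d′q≡e e<d′)))

        advance : ∀ c → Marked c P →
                  WP (do! (#q ≔ F[ var #q ])) Inner (Solved (suc L)) (record s { d = d′ ; checked = c })
                     (3 + (m₁ * 30 + tail))
        advance c marked′ = wp-do (record
          { added = added-⊑ d′⊑d marked′ added ; k≤i = k≤i ; i≤j = i≤j ; e≡i∸k = e≡i∸k
          ; q-ends = F-endsAt q≢I q-ends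
          ; sound = sound′
          ; processed = λ p k≤p p<i → reached-⊑ d′⊑d (processed p k≤p p<i)
          ; walked = λ r r-i F<r → case F-or-self q≢I q-ends r-i F<r of λ where
              (inj₁ q<r)  → ≤⁺-trans ≤-trans (at d′⊑d r) (walked r r-i q<r)
              (inj₂ refl) → ≤⁺-reflexive-≡ ≤-reflexive d′q≡e
          ; credit = ≤-refl
          })
          where
          sound′ : ∀ r m → lookup d′ r ≡ [ m ] →
                   Justified d′ P r m ⊎ (ℓ (F q) < ℓ r × r endsAt i × m ≡ e)
          sound′ r m d′r≡m with r Fin.≟ q
          ... | yes refl = inj₂ (ℓF< q≢I , q-ends , []-injective (trans (sym d′r≡m) d′q≡e))
          ... | no  r≢q with sound r m (trans (sym (Vec.lookup∘update′ r≢q d [ e ])) d′r≡m)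
          ...   | inj₁ justified           = inj₁ (justified-⊑ d′⊑d justified)
          ...   | inj₂ (q<r , r-i , m≡e) = inj₂ (<-trans (ℓF< q≢I) q<r , r-i , m≡e)

        i≡k+e : i ≡ k + e
        i≡k+e = trans (sym (m+[n∸m]≡n k≤i)) (cong (k +_) (sym e≡i∸k))

        marked-q : lookup d′ q <⁺ [ ℓ q ] → Marked (checked ∪ ⁅ q ⁆) P
        marked-q d′q<ℓ r r∈ r≢I with Subset.x∈p∪q⁻ checked ⁅ q ⁆ r∈
        ... | inj₁ r∈c = marked r r∈c r≢I
        ... | inj₂ r∈q with refl ← Subset.x∈⁅y⁆⇒x≡y q r∈q =
          i , k , q-ends , k∈P , k≤i ,
          subst (_< k + ℓ q) (sym i≡k+e) (+-monoʳ-< k ([<]-injective (subst (_<⁺ [ ℓ q ]) d′q≡e d′q<ℓ)))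

      inner-body : ∃[ κ′ ] (9 + κ′ ≤ κ × WP
        (do! (d[ var #q ]≔ fin (var #e)) ⨾
         (if d[ var #q ] <ᵈ fin ℓ[ var #q ] then
           ( do! checked≔checked∪｛ var #q ｝ ⨾
             (if ∣checked∣ ≡′ ∣S∣ then return))) ⨾
         do! (#q ≔ F[ var #q ])) Inner (Solved (suc L)) s κ′)
      inner-body = 21 + (m₁ * 30 + tail) , ≤-trans (+-monoˡ-≤ tail (*-monoˡ-≤ 30 fewer)) credit ,
        wp-seq (wp-do (wp-seq (wp-if
          (λ short → wp-seq (wp-do (wp-if
            -- A subset with `size` elements contains every state, so `Marked` yields coverage of
            -- them all.
            (λ full → wp-return (|P| , positions , λ r →
                marked-q short r (subst (r Subset.∈_) (sym (Subset.∣p∣≡n⇒p≡⊤ full)) Subset.∈⊤)))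
            (λ _ → wp-weaken (m≤n+m _ 3) (advance _ (marked-q short))))))
          (λ _ → wp-weaken (m≤n+m _ 8) (advance _ marked)))))

    inner-exit : ∀ {s κ} → Inner s κ →
      ¬ (Store.q s ≢ initial × [ Store.e s ] <⁺ lookup (Store.d s) (Store.q s)) →
      ∃[ κ′ ] (9 + κ′ ≤ κ × WP (do! (#i ≔ var #i ⊕ lit 1)) Outer (Solved (suc L)) s κ′)
    inner-exit {s} {κ} inv stop = 4 + after , enough ,
      wp-do (subst (λ x → Outer (record s { i = x }) after) (+-comm 1 i) (record
        { added = added ; k≤i = m≤n⇒m≤1+n k≤i ; i≤1+j = s≤s i≤j
        ; sound = λ r m dr≡m → case sound r m dr≡m of λ where
            (inj₁ justified)          → justified
            -- The chain at `i` is now complete, so pending entries are justified by `i` itself and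
            -- the new position `k`.
            (inj₂ (_ , r-i , refl)) → i , k , r-i , k∈P , i≡k+e , reached
        ; processed = λ p k≤p p<1+i → case m≤n⇒m<n∨m≡n (s≤s⁻¹ p<1+i) of λ where
            (inj₁ p<i)  → processed p k≤p p<i
            (inj₂ refl) → subst (Reached d p) e≡i∸k reached
        ; credit = ≤-refl
        }))
      where
      open Store s
      open Inner inv
      open Added added
      y = (j ∸ i) * 30 + (3 + rest)
      after = count (farther? (suc i ∸ k) d) * 30 + y
      i≡k+e : i ≡ k + e
      i≡k+e = trans (sym (m+[n∸m]≡n k≤i)) (cong (k +_) (sym e≡i∸k))
      stopped : q ≢ initial → lookup d q ≤⁺ [ e ]
      stopped q≢I = ≮⁺⇒≥⁺ λ e<d → stop (q≢I , e<d)
      reached : Reached d i e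
      reached r r≢I r-i with ≤-<-connex (ℓ r) (ℓ q)
      ... | inj₂ q<r = walked r r-i q<r
      ... | inj₁ r≤q with lookup d q in dq≡ | stopped q≢I
        where
        q≢I : q ≢ initial
        q≢I q≡I = n≮0 (<-≤-trans (ℓ>0 r≢I) (≤-trans r≤q (≤-reflexive (trans (cong ℓ q≡I) ℓ-initial))))
      -- The position `p` that justifies the value at `q` has its whole chain at values at most `m`;
      -- `r`, no longer than `q`, belongs to that chain too. And `q` is not pending, since pending
      -- states lie strictly above it.
      ...   | [ m ] | m≤e with sound q m dq≡
      ...     | inj₁ (p , _ , q-p , _ , _ , reached-p) =
        ≤⁺-trans ≤-trans (reached-p r r≢I (endsAt-mono r-i q-ends r≤q q-p)) m≤e
      ...     | inj₂ (q<q , _) = contradiction q<q (<-irrefl refl)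
      fewer : count (farther? (suc i ∸ k) d) ≤ count (farther? e d)
      fewer = count-mono (farther? (suc i ∸ k) d) (farther? e d) λ r →
        <⁺-transʳ ≤-<-trans [ subst (_≤ suc i ∸ k) (sym e≡i∸k) (∸-monoˡ-≤ k (n≤1+n i)) ]
      enough : 13 + (count (farther? (suc i ∸ k) d) * 30 + y) ≤ κ
      enough = begin
        13 + (x * 30 + y)                     ≡⟨ +-assoc 13 (x * 30) y ⟨
        13 + x * 30 + y                       ≡⟨ cong (_+ y) (+-comm 13 (x * 30)) ⟩
        x * 30 + 13 + y                       ≡⟨ +-assoc (x * 30) 13 y ⟩
        x * 30 + (13 + y)                     ≤⟨ +-monoˡ-≤ (13 + y) (*-monoˡ-≤ 30 fewer) ⟩
        count (farther? e d) * 30 + (13 + y)  ≤⟨ credit ⟩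
        κ                                     ∎
        where
        open ≤-Reasoning
        x = count (farther? (suc i ∸ k) d)

    outer-body : ∀ {s κ} → Outer s κ → Store.i s ≤ Store.j s →
      ∃[ κ′ ] (3 + κ′ ≤ κ × WP
        ((do! (#e ≔ var #i ⊖ var #k) ⨾
          do! (#q ≔ T[ var #i ]) ⨾
          (while (var #q ≢′ I) and (fin (var #e) <ᵈ d[ var #q ]) repeat
            ( do! (d[ var #q ]≔ fin (var #e)) ⨾
              (if d[ var #q ] <ᵈ fin ℓ[ var #q ] then
                ( do! checked≔checked∪｛ var #q ｝ ⨾
                  (if ∣checked∣ ≡′ ∣S∣ then return))) ⨾
              do! (#q ≔ F[ var #q ])))) ⨾
         do! (#i ≔ var #i ⊕ lit 1)) Outer (Solved (suc L)) s κ′)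
    outer-body {s} {κ} inv i≤j = 27 + (x * 30 + y) , enough ,
      wp-seq (wp-seq (wp-do (wp-seq (wp-do (wp-while Inner (λ _ _ inv (q≢I , e<d) → inner-body inv q≢I e<d)
                                                           (λ _ _ → inner-exit) (record
        { added = added ; k≤i = k≤i ; i≤j = i≤j ; e≡i∸k = refl
        ; q-ends = T-endsAt 1≤i (≤-trans i≤j j≤n)
        ; sound = λ r m dr≡m → inj₁ (sound r m dr≡m)
        ; processed = processed
        ; walked = λ r r-i T<r → contradiction T<r (≤⇒≯ (T-lowest 1≤i r-i))
        ; credit = begin
            x * 30 + (13 + y)  ≡⟨ +-assoc (x * 30) 13 y ⟨
            x * 30 + 13 + y    ≡⟨ cong (_+ y) (+-comm (x * 30) 13) ⟩
            13 + (x * 30 + y)  ≤⟨ m≤n+m _ 7 ⟩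
            20 + (x * 30 + y)  ∎
        }))))))
      where
      open Store s
      open Outer inv
      open Added added
      open ≤-Reasoning
      x = count (farther? (i ∸ k) d)
      y = (j ∸ i) * 30 + (3 + rest)
      1≤i : 1 ≤ i
      1≤i = ≤-trans 1≤k k≤i
      enough : 30 + (x * 30 + y) ≤ κ
      enough = begin
        30 + (x * 30 + y)                         ≡⟨ +-assoc 30 (x * 30) y ⟨
        30 + x * 30 + y                           ≡⟨ cong (_+ y) (+-comm 30 (x * 30)) ⟩
        x * 30 + 30 + y                           ≡⟨ +-assoc (x * 30) 30 y ⟩
        x * 30 + (suc (j ∸ i) * 30 + (3 + rest))  ≡⟨ cong (λ p → x * 30 + (p * 30 + (3 + rest))) (+-∸-assoc 1 i≤j) ⟨
        x * 30 + ((suc j ∸ i) * 30 + (3 + rest))  ≤⟨ credit ⟩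
        κ                                         ∎

    outer-exit : ∀ {s κ} → Outer s κ → ¬ (Store.i s ≤ Store.j s) → ∃[ κ′ ] (3 + κ′ ≤ κ × Done s κ′)
    outer-exit {s} inv i≰j = rest , enough , record
      { added = added ; sound = sound
      ; processed = λ p k≤p p≤j → processed p k≤p (≤-<-trans p≤j (≰⇒> i≰j)) ; credit = ≤-refl }
      where
      open Store s
      open Outer inv
      enough : 3 + rest ≤ _
      enough = ≤-trans (≤-trans (m≤n+m (3 + rest) ((suc j ∸ i) * 30))
                                (m≤n+m _ (count (farther? (i ∸ k) d) * 30))) credit

    updating-wp : ∀ {s} → AddedAt J L s → Sound (Store.d s) (Store.P s) →
                  WP updating Done (Solved (suc L)) s (2 + (size * 30 + (Store.j s * 30 + (3 + rest))))
    updating-wp {s} added sound =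
      wp-seq (wp-do (wp-while Outer (λ _ _ → outer-body) (λ _ _ → outer-exit) (record
        { added = added ; k≤i = ≤-refl ; i≤1+j = m≤n⇒m≤1+n k≤j ; sound = sound
        ; processed = λ p k≤p p<k → contradiction k≤p (<⇒≱ p<k)
        ; credit = +-mono-≤ (*-monoˡ-≤ 30 (count≤ (farther? (k ∸ k) d)))
                            (+-monoˡ-≤ (3 + rest) (*-monoˡ-≤ 30 window≤))
        })))
      where
      open Store s
      open Added added
      window≤ : suc j ∸ k ≤ j
      window≤ = ∸-monoʳ-≤ {m = 1} {n = k} (suc j) 1≤k

-- The whole run

module Analysis {A : Set} (_≟ᴬ_ : DecidableEquality A) {w : List A} (S : SuffixAutomaton w) where

  open SuffixAutomaton S
  open StateProperties _≟ᴬ_ S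
  open StateCount _≟ᴬ_ S using (size≤)
  open Algorithm S renaming (i to #i; j to #j; k to #k; e to #e; q to #q)
  open Credit S
  open Invariants _≟ᴬ_ S
  module Stacking = StackingAnalysis _≟ᴬ_ S
  module Updating = UpdatingAnalysis _≟ᴬ_ S

  private
    n = length w

  -- In `afterStacking` the units are: 2 for adding, 2 for `i ≔ k`, 3 for the last test of updating,
  -- 4 for `j ≔ k - 1`. In `roundCost` the leading 4 pays for the two assignments opening stacking.
  afterStacking roundCost : ℕ
  afterStacking = 2 + (2 + (size * 30 + (n * 30 + (3 + 4))))
  roundCost     = 4 + (size * 30 + (n * 30 + (3 + afterStacking)))

  module _ {J L : ℕ} where

    add-k : ∀ {s κ} → Stacking.Done (suc J) L afterStacking s κ →
            let s′ = perform P≔P∪｛ var #k ｝ s in AddedAt (suc J) L s′ × Sound (Store.d s′) (Store.P s′)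
    add-k {s} done = subst (λ P′ → Added (suc J) L k j d P′ checked × Sound d P′) (sym (insert-fresh k<P)) (record
      { 1≤k = 1≤k ; k≤j = k≤j ; j≤J = j≤J ; j≤n = j≤n
      ; k≤P = ≤-refl ∷ All.map <⇒≤ k<P ; k∈P = here refl ; |P| = cong suc |P|
      ; positions = (1≤k , ≤-trans k≤j j≤n) ∷ positions
      ; marked = λ q q∈ q≢I → covered-⊆ there (marked q q∈ q≢I)
      ; ready = ready ; stacked = stacked
      } , λ q m dq≡m → justified-⊆ {d = d} there (sound q m dq≡m))
      where
      open Store s
      open Stacking.Done done
      open Round round
      k<P : All (k <_) P
      k<P = All.map (≤-<-trans k≤j) fresh

    -- For `POS q` between `k` and the old `j`, treating position `POS q` left `d[q] ≤ POS q - k`,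
    -- and if `d[q]` was not already short, `k` was chosen with `POS q < k + ℓ q`.
    next-round : ∀ {s κ} → Updating.Done (suc J) L 4 s κ → RoundAt J (suc L) (perform (#j ≔ var #k ⊖ lit 1) s)
    next-round {s} done = record
      { j≤J = ∸-monoˡ-≤ 1 (≤-trans k≤j j≤J)
      ; j≤n = ≤-trans (m∸n≤m k 1) (≤-trans k≤j j≤n)
      ; fresh = All.map (λ {t} k≤t → subst (_≤ t) (sym k≡) k≤t) k≤P
      ; |P| = |P| ; positions = positions ; sound = sound ; marked = marked
      ; ready = λ q q≢I k∸1<q → short q q≢I (subst (_≤ POS q) k≡ k∸1<q)
      }
      where
      open Store s
      open Updating.Done done
      open Added added
      k≡ : suc (k ∸ 1) ≡ k
      k≡ = m+[n∸m]≡n 1≤k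
      short : ∀ q → q ≢ initial → k ≤ POS q → Short d q
      short q q≢I k≤q with ≤-<-connex (POS q) j
      ... | inj₂ j<q = ready q q≢I j<q
      ... | inj₁ q≤j with stacked q k≤q q≤j
      ...   | inj₁ short-q = short-q
      ...   | inj₂ q<k+ℓ = <⁺-transʳ ≤-<-trans (processed (POS q) k≤q q≤j q q≢I endsAt-POS)
                             [ +-cancelˡ-< k _ _ (subst (_< k + ℓ q) (sym (m+[n∸m]≡n k≤q)) q<k+ℓ) ]

    round-wp : ∀ {s} → RoundAt (suc J) L s → 1 ≤ Store.j s →
      WP (stacking ⨾ adding ⨾ updating ⨾ do! (#j ≔ var #k ⊖ lit 1))
         (λ s′ _ → RoundAt J (suc L) s′) (Solved (suc L)) s roundCost
    round-wp {s} round 1≤j = wp-weaken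
      (+-monoʳ-≤ 4 (+-monoʳ-≤ (size * 30) (window (3 + afterStacking) (Round.j≤n round))))
      (wp-seq (wp-mono after-stacking (Stacking.stacking-wp (suc J) L afterStacking round 1≤j)))
      where
      window : ∀ x {j} → j ≤ n → j * 30 + x ≤ n * 30 + x
      window x j≤n = +-monoˡ-≤ x (*-monoˡ-≤ 30 j≤n)
      after-updating : ∀ s κ → Updating.Done (suc J) L 4 s κ →
        WP (do! (#j ≔ var #k ⊖ lit 1)) _ (Solved (suc L)) s κ
      after-updating s κ done = wp-weaken (Updating.Done.credit done) (wp-do {κ = 0} (next-round done))
      after-stacking : ∀ s κ → Stacking.Done (suc J) L afterStacking s κ →
        WP (adding ⨾ updating ⨾ do! (#j ≔ var #k ⊖ lit 1)) _ (Solved (suc L)) s κ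
      after-stacking s κ done = wp-weaken (Stacking.Done.credit done)
        (wp-seq (wp-do (wp-seq (wp-mono after-updating
          (wp-weaken (+-monoʳ-≤ 2 (+-monoʳ-≤ (size * 30) (window 7 (Round.j≤n (Stacking.Done.round done)))))
            (uncurry (Updating.updating-wp (suc J) L 4) (add-k done)))))))

  -- `WP` needs its budget beforehand, whereas the total depends on the final number `L` of
  -- positions; here the time is related to `L` after the fact.
  Result : Cmd → Store → (ℕ → ℕ → Set) → Set
  Result c s Bound = ∃[ o ] ∃[ s′ ] ∃[ t ] ∃[ L ] ((⟨ c , s ⟩⇓⟨ o , s′ ⟩ t) × Solved L s′ × Bound t L)

  seq-result : ∀ {c₁ c₂ s s₁ t Bound Bound′} → ⟨ c₁ , s ⟩⇓⟨ normal , s₁ ⟩ t →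
               (∀ {t′ L} → Bound t′ L → Bound′ (t + t′) L) → Result c₂ s₁ Bound → Result (c₁ ⨾ c₂) s Bound′
  seq-result run bound (_ , _ , _ , _ , run′ , solved , t′≤) = _ , _ , _ , _ , seq run run′ , solved , bound t′≤

  iteration rounds : Cmd
  iteration = stacking ⨾ adding ⨾ updating ⨾ do! (#j ≔ var #k ⊖ lit 1)
  rounds    = while lit 0 <′ var #j repeat iteration

  module _ (K : ℕ)
    (iteration-wp : ∀ {J L s} → RoundAt (suc J) L s → 1 ≤ Store.j s →
       WP iteration (λ s′ _ → RoundAt J (suc L) s′) (Solved (suc L)) s K) where

    -- A round costs at most `3 + K`, test included, and raises the number of positions by one, so
    -- the bound telescopes; the final 3 is the failing test.
    rounds-result : ∀ J {L s} → Dec (0 < Store.j s) → RoundAt J L s →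
      Result rounds s (λ t L′ → t + L * (3 + K) ≤ L′ * (3 + K) + 3)
    rounds-result J {L} {s} (no j≯0) round = _ , _ , _ , _ , while-false j≯0 ,
      (Round.|P| round , Round.positions round , λ q q≢I →
        short⇒covered {d = Store.d s} (Round.sound round) (Round.ready round q q≢I (≤-<-trans (≮⇒≥ j≯0) (POS>0 q≢I)))) ,
      ≤-reflexive (+-comm 3 (L * (3 + K)))
    rounds-result zero        (yes j>0) round = contradiction (<-≤-trans j>0 (Round.j≤J round)) n≮0
    rounds-result (suc J) {L} {s} (yes j>0) round = continue (iteration-wp round j>0)
      where
      open ≤-Reasoning
      continue : WP iteration (λ s′ _ → RoundAt J (suc L) s′) (Solved (suc L)) s K →
                 Result rounds s (λ t L′ → t + L * (3 + K) ≤ L′ * (3 + K) + 3)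
      continue (wp {returned} {time = t} run t≤ solved) = _ , _ , _ , _ , while-returned j>0 run , solved , (begin
        3 + t + L * (3 + K)          ≤⟨ +-monoˡ-≤ (L * (3 + K)) (+-monoʳ-≤ 3 (m+n≤o⇒m≤o t t≤)) ⟩
        3 + K + L * (3 + K)          ≤⟨ m≤m+n _ 3 ⟩
        3 + K + L * (3 + K) + 3      ∎)
      continue (wp {normal} {s′} {t} run t≤ round′) with rounds-result J (0 <? Store.j s′) round′
      ... | _ , _ , t′ , L′ , run′ , solved , t′≤ = _ , _ , _ , _ , while-true j>0 run run′ , solved , (begin
        3 + t + t′ + L * (3 + K)     ≤⟨ +-monoˡ-≤ (L * (3 + K)) (+-monoˡ-≤ t′ (+-monoʳ-≤ 3 (m+n≤o⇒m≤o t t≤))) ⟩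
        3 + K + t′ + L * (3 + K)     ≡⟨ cong (_+ L * (3 + K)) (+-comm (3 + K) t′) ⟩
        t′ + (3 + K) + L * (3 + K)   ≡⟨ +-assoc t′ (3 + K) (L * (3 + K)) ⟩
        t′ + suc L * (3 + K)         ≤⟨ t′≤ ⟩
        L′ * (3 + K) + 3             ∎)

  -- The disjunction carries the entries already reset through the induction. A state costs 4: one
  -- unit for the loop and three for the assignment.
  resetting-wp : ∀ {R} qs s κ → WP (for-q∈ qs repeat do! (d[ var #q ]≔ ∞))
    (λ s′ κ′ → κ ≤ κ′ × (∀ q → q ∈ qs ⊎ lookup (Store.d s) q ≡ ⊤⁺ → lookup (Store.d s′) q ≡ ⊤⁺))
    R s (length qs * 4 + (1 + κ))
  resetting-wp []       s κ = wp for-[] ≤-refl (≤-refl , λ { q (inj₂ dq≡) → dq≡ })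
  resetting-wp (r ∷ qs) s κ with resetting-wp qs (record s { q = r ; d = Store.d s [ r ]≔ ⊤⁺ }) κ
  ... | wp {returned} run t≤ p = wp (for-∷ do! run) (+-monoʳ-≤ 4 t≤) p
  ... | wp {normal}   run t≤ (κ≤ , cleared) = wp (for-∷ do! run) (+-monoʳ-≤ 4 t≤) (κ≤ , λ where
      q (inj₁ (here refl))  → cleared q (inj₂ (Vec.lookup∘update r (Store.d s) ⊤⁺))
      q (inj₁ (there q∈qs)) → cleared q (inj₁ q∈qs)
      q (inj₂ dq≡)          → cleared q (inj₂ (update-⊤ q dq≡)))
    where
    update-⊤ : ∀ q → lookup (Store.d s) q ≡ ⊤⁺ → lookup (Store.d s [ r ]≔ ⊤⁺) q ≡ ⊤⁺
    update-⊤ q dq≡ with q Fin.≟ r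
    ... | yes refl = Vec.lookup∘update r (Store.d s) ⊤⁺
    ... | no  q≢r  = trans (Vec.lookup∘update′ q≢r (Store.d s) ⊤⁺) dq≡

  initialization-wp : ∀ s → WP initialization (λ s′ _ → RoundAt n 0 s′) (λ _ → ⊥) s (size * 4 + 6)
  initialization-wp s = subst (λ l → WP initialization (λ s′ _ → RoundAt n 0 s′) (λ _ → ⊥) s (l * 4 + 6))
    (List.length-tabulate {n = size} (λ q → q))
    (wp-seq (wp-mono (λ s′ κ′ (5≤κ′ , cleared) → wp-weaken 5≤κ′
      (wp-seq (wp-do (wp-seq (wp-do (wp-do {κ = 0} (start s′ (λ q → cleared q (inj₁ (∈-allFin q)))))))))
      ) (resetting-wp (allFin size) s 5)))
    where
    start : ∀ s → (∀ q → lookup (Store.d s) q ≡ ⊤⁺) → Round n 0 n (Store.d s) [] ⁅ initial ⁆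
    start s cleared = record
      { j≤J = ≤-refl ; j≤n = ≤-refl ; fresh = [] ; |P| = refl ; positions = []
      ; sound = λ q m dq≡m → case trans (sym (cleared q)) dq≡m of λ ()
      ; marked = λ q q∈ q≢I → contradiction (Subset.x∈⁅y⁆⇒x≡y initial q∈) q≢I
      ; ready = λ q _ n<q → contradiction (proj₁ (endsAt-POS {q})) (<⇒≱ n<q)
      }

  getAnAttractor-result : ∀ s → Result getAnAttractor s (λ t L → t ≤ size * 4 + 6 + (L * (3 + roundCost) + 3))
  getAnAttractor-result s = continue (initialization-wp s)
    where
    continue : WP initialization (λ s′ _ → RoundAt n 0 s′) (λ _ → ⊥) s (size * 4 + 6) →
               Result getAnAttractor s (λ t L → t ≤ size * 4 + 6 + (L * (3 + roundCost) + 3))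
    continue (wp {normal} {s′} {t} run t≤ round) =
      seq-result run (λ {t′} t′≤ → +-mono-≤ (m+n≤o⇒m≤o t t≤) (m+n≤o⇒m≤o t′ t′≤))
        (rounds-result roundCost round-wp n (0 <? Store.j s′) round)

  -- Every word of a class is at least `ℓ` long, so a position inside its shortest word lies inside
  -- `u`. The class of `u` is not `initial`, since `u` would then end at position 0.
  covered⇒attractor : ∀ {P} → Positions P → (∀ q → q ≢ initial → Covered P q) → IsAttractor w P
  covered⇒attractor {P} positions covered = positions , λ u u≢[] fu → occurrence u≢[] fu (covered (δ u fu) λ δ≡I →
    u≢[] (ends-0 {w = w} (endsAt⇒∈ˢ (fu , δ≡I) (initial-endsAt z≤n))))
    where
    occurrence : ∀ {u} → u ≢ [] → (fu : Factor w u) → Covered P (δ u fu) →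
                 ∃₂ λ i p → Occurrence w u i p × (∃[ t ] (t ∈ P × i ≤ t × t ≤ p))
    occurrence {u} u≢[] fu (p , t , q-p , t∈P , t≤p , p<t+ℓ)
      with i , occ , i+|u|≡ ← ends⇒occurrence u≢[] (endsAt⇒∈ˢ (fu , refl) q-p) =
      i , p , occ , t , t∈P , +-cancelʳ-≤ (length u) i t i+|u|≤t+|u| , t≤p
      where
      open ≤-Reasoning
      i+|u|≤t+|u| : i + length u ≤ t + length u
      i+|u|≤t+|u| = begin
        i + length u        ≡⟨ i+|u|≡ ⟩
        suc p               ≤⟨ p<t+ℓ ⟩
        t + ℓ (δ u fu)      ≤⟨ +-monoʳ-≤ t (proj₂ (ℓ-def (δ u fu)) u (fu , refl)) ⟩
        t + length u        ∎

-- The explicit constant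

attractor-nonempty : ∀ {A : Set} {w : List A} {P} → w ≢ [] → IsAttractor w P → 1 ≤ length P
attractor-nonempty {w = w} {P} w≢[] (_ , covers)
  with covers w w≢[] (ends⇒factor (≤-refl , Suffix.here (≡⇒Pointwise-≡ (sym (List.take-all (length w) w ≤-refl)))))
... | _ , _ , _ , _ , here _  , _ = s≤s z≤n
... | _ , _ , _ , _ , there _ , _ = s≤s z≤n

attractor-of-[] : ∀ {A : Set} {P} → IsAttractor {A} [] P → P ≡ []
attractor-of-[] ([] , _) = refl
attractor-of-[] ((1≤t , t≤0) ∷ _ , _) = contradiction (≤-trans 1≤t t≤0) n≮0

-- The bound of `getAnAttractor-result` with `roundCost` unfolded, in the number of states, the
-- length of the word and the number of positions.
cost : ℕ → ℕ → ℕ → ℕ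
cost s n p = s * 4 + 6 + (p * (3 + (4 + (s * 30 + (n * 30 + (3 + (2 + (2 + (s * 30 + (n * 30 + (3 + 4)))))))))) + 3)

cost-mono : ∀ {s s′} n p → s ≤ s′ → cost s n p ≤ cost s′ n p
cost-mono {s} {s′} n p s≤s′ =
  +-mono-≤ (+-monoˡ-≤ 6 (*-monoˡ-≤ 4 s≤s′)) (+-monoˡ-≤ 3 (*-monoʳ-≤ p (+-monoʳ-≤ 7
    (+-mono-≤ s*30 (+-monoʳ-≤ (n * 30) (+-monoʳ-≤ 7 (+-monoˡ-≤ _ s*30)))))))
  where
  s*30 : s * 30 ≤ s′ * 30
  s*30 = *-monoˡ-≤ 30 s≤s′

cost-expand : ∀ n p → cost (n * 4) n p ≡ n * 16 + p * 21 + 9 + (n * p) * 300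
cost-expand = solve 2 (λ n p →
    n :* con 4 :* con 4 :+ con 6 :+
      (p :* (con 3 :+ (con 4 :+ (n :* con 4 :* con 30 :+ (n :* con 30 :+ (con 3 :+ (con 2 :+ (con 2 :+
        (n :* con 4 :* con 30 :+ (n :* con 30 :+ (con 3 :+ con 4)))))))))) :+ con 3)
    := n :* con 16 :+ p :* con 21 :+ con 9 :+ (n :* p) :* con 300) refl
  where open +-*-Solver

cost-bound : ∀ {s} n p → 1 ≤ n → 1 ≤ p → s ≤ suc n + suc n → cost s n p ≤ 346 * (n * p)
cost-bound {s} n p 1≤n 1≤p s≤ = begin
  cost s n p                                           ≤⟨ cost-mono n p s≤4n ⟩
  cost (n * 4) n p                                     ≡⟨ cost-expand n p ⟩
  n * 16 + p * 21 + 9 + x * 300                        ≤⟨ +-monoˡ-≤ (x * 300) (+-mono-≤ (+-mono-≤ (*-monoˡ-≤ 16 n≤x) (*-monoˡ-≤ 21 p≤x)) (*-monoˡ-≤ 9 1≤x)) ⟩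
  x * 16 + x * 21 + x * 9 + x * 300                    ≡⟨ solve 1 (λ x → x :* con 16 :+ x :* con 21 :+ x :* con 9 :+ x :* con 300 := con 346 :* x) refl x ⟩
  346 * x                                              ∎
  where
  open ≤-Reasoning
  open +-*-Solver
  x = n * p
  1≤x : 1 ≤ x
  1≤x = *-mono-≤ 1≤n 1≤p
  n≤x : n ≤ x
  n≤x = subst (_≤ x) (*-identityʳ n) (*-monoʳ-≤ n 1≤p)
  p≤x : p ≤ x
  p≤x = subst (_≤ x) (*-identityˡ p) (*-monoˡ-≤ p 1≤n)
  -- For `n ≥ 1`, 2 (n + 1) is at most 4 n; with this value every term of the cost is at most a
  -- multiple of n p, and 16 + 21 + 9 + 300 = 346.
  s≤4n : s ≤ n * 4
  s≤4n = ≤-trans s≤ (≤-trans (+-mono-≤ (+-monoˡ-≤ n 1≤n) (+-monoˡ-≤ n 1≤n))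
           (≤-reflexive (solve 1 (λ n → n :+ n :+ (n :+ n) := n :* con 4) refl n)))

attractor-bound : ∀ {A : Set} {w : List A} {P s t} → IsAttractor w P → s ≤ suc (length w) + suc (length w) →
                  t ≤ cost s (length w) (length P) → t ≤ 346 * (1 ⊔ length w * length P)
-- The empty word forces `P` to be empty, so the product vanishes and the `1 ⊔` of the bound takes
-- over: at most two states give a cost of 17.
attractor-bound {w = []} attractor s≤2 t≤ with refl ← attractor-of-[] attractor =
  ≤-trans t≤ (≤-trans (cost-mono 0 0 s≤2) (m≤m+n 17 329))
attractor-bound {w = w@(_ ∷ _)} {P} attractor s≤ t≤ =
  ≤-trans t≤ (≤-trans (cost-bound (length w) (length P) (s≤s z≤n) (attractor-nonempty (λ ()) attractor) s≤)
                      (*-monoʳ-≤ 346 (m≤n⊔m 1 (length w * length P))))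

proposition6 : ∃[ C ] (∀ (σ : ℕ) (w : List (Fin σ)) (S : SuffixAutomaton w) →
    let open Algorithm S in
    ∀ (s₀ : Store) →
    ∃[ P ] ∃[ t ] (
    (getAnAttractor-from s₀ produces P inTime t) ×
    IsAttractor w P ×
    t ≤ C * (1 ⊔ (length w * length P))))
proposition6 = 346 , λ σ w S s₀ → result S (Analysis.getAnAttractor-result Fin._≟_ S s₀)
  where
  result : ∀ {σ w} (S : SuffixAutomaton {Fin σ} w) {s₀} → let open Algorithm S in
    Analysis.Result Fin._≟_ S getAnAttractor s₀
      (λ t L → t ≤ cost (SuffixAutomaton.size S) (length w) L) →
    ∃[ P ] ∃[ t ] ((getAnAttractor-from s₀ produces P inTime t) × IsAttractor w P ×
                   t ≤ 346 * (1 ⊔ (length w * length P)))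
  result S (o , s , t , _ , run , (refl , positions , covered) , t≤) =
    Algorithm.Store.P s , t , (o , s , run , refl) , attractor , attractor-bound attractor (StateCount.size≤ Fin._≟_ S) t≤
    where
    attractor : IsAttractor _ (Algorithm.Store.P s)
    attractor = Analysis.covered⇒attractor Fin._≟_ S positions covered
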